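{- Let $M=(E,r)$ be a matroid with $E$ nonempty, and write $r(M)=r(E)$. Then \[ Q'_M(x,y)=\frac{x^{|E|-r(M)}\,y^{r(M)}}{x+y-1}\cdot T_M\!\left(\frac{x+y-1}{y},\ \frac{x+y-1}{x}\right), \] as an identity of rational functions.
   Context: For a polymatroid (in particular a matroid) $M=(E,r)$ with ground set $E$, a base is a vector $\mathbf x\in\mathbb Z^E$ with $\sum_{i\in E}x_i=r(E)$ and $\sum_{i\in S}x_i\le r(S)$ for all $S\subseteq E$; $P(M)$ is the convex hull of the bases. For a matroid, the bases are exactly the indicator vectors $\mathbf e_B$ of the matroid bases $B$. Let $\Delta=\operatorname{conv}\{\mathbf e_i:i\in E\}\subseteq\mathbb R^E$ and $\nabla=-\Delta$. For integers $t,u\ge 0$ let $Q_M(t,u)=\#\big((P(M)+u\Delta+t\nabla)\cap\mathbb Z^E\big)$ (Minkowski sum). This is a polynomial in $t,u$ (of degree $|E|-1$); write it uniquely as $Q_M(t,u)=\sum_{i,j}c_{ij}\binom{u}{j}\binom{t}{i}$ and define $Q'_M(x,y)=\sum_{i,j}c_{ij}(x-1)^i(y-1)^j$. The Tutte polynomial is $T_M(x,y)=\sum_{S\subseteq E}(x-1)^{r(E)-r(S)}(y-1)^{|S|-r(S)}$.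
   Formalization: The polytopes P(M), Δ, ∇ and their Minkowski sums are formed in rational space Q^E with rational convex weights instead of in R^E; their integer points are the same, by feasibility of rational linear systems. -}

module Defs where

open import Algebra.Bundles using (CommutativeRing)
import Algebra.Morphism.Structures as Morphism
import Algebra.Properties.Monoid.Sum as MonoidSum
import Algebra.Properties.Semiring.Exp as Exp
open import Data.Bool.Base using (if_then_else_)
open import Data.Fin.Base using (Fin; toℕ)
open import Data.Fin.Subset using (Subset; inside; outside; _⊆_; _∪_; _∩_; ∣_∣; ⊤)
open import Data.Integer.Base as ℤ using (ℤ; +_)
import Data.Integer.Properties as ℤₚ
open import Data.List.Base using (List; length)
open import Data.List.Membership.Propositional using (_∈_)
open import Data.List.Relation.Unary.Unique.Propositional using (Unique)
open import Data.Nat.Base as ℕ using (ℕ; zero; suc)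
open import Data.Nat.Combinatorics using (_C_)
open import Data.Product using (∃; ∃-syntax; _×_)
open import Data.Rational.Base as ℚ using (ℚ; 0ℚ; 1ℚ)
import Data.Rational.Properties as ℚₚ
open import Data.Vec.Base using (Vec; []; _∷_; lookup; map; zipWith; replicate; tabulate; _[_]≔_)
open import Function.Bundles using (_⇔_)
open import Level using (0ℓ)
open import Relation.Binary.PropositionalEquality using (_≡_)
open import Relation.Unary using (Pred)

open MonoidSum ℤₚ.+-0-monoid using () renaming (sum to sumℤ)
open MonoidSum ℚₚ.+-0-monoid using () renaming (sum to sumℚ)

-- A matroid on the ground set E = Fin n, given by its rank function.
record Matroid (n : ℕ) : Set where
  field
    r          : Subset n → ℕ
    r-bounded  : ∀ S → r S ℕ.≤ ∣ S ∣
    r-monotone : ∀ {S T} → S ⊆ T → r S ℕ.≤ r T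
    r-submod   : ∀ S T → r (S ∪ T) ℕ.+ r (S ∩ T) ℕ.≤ r S ℕ.+ r T

  rank : ℕ
  rank = r ⊤

-- Regions of ℚᴱ.  All polytopes below are built from integer points and
-- integer dilation factors, so their lattice points are the same whether
-- they are formed in ℚᴱ or in ℝᴱ.
Region : ℕ → Set₁
Region n = Pred (Vec ℚ n) 0ℓ

fromℤ : ℤ → ℚ
fromℤ z = z ℚ./ 1

fromℕ : ℕ → ℚ
fromℕ k = fromℤ (+ k)

conv : ∀ {n} → Region n → Region n
conv {n} A p =
  ∃[ k ] ∃ λ (w : Fin k → ℚ) → ∃ λ (v : Fin k → Vec ℚ n) →
    (∀ i → 0ℚ ℚ.≤ w i) ×
    sumℚ w ≡ 1ℚ ×
    (∀ i → A (v i)) ×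
    p ≡ tabulate (λ j → sumℚ (λ i → w i ℚ.* lookup (v i) j))

infixl 6 _⊕_
infixr 7 _•_

_⊕_ : ∀ {n} → Region n → Region n → Region n
(A ⊕ B) p = ∃[ a ] ∃[ b ] A a × B b × p ≡ zipWith ℚ._+_ a b

_•_ : ∀ {n} → ℚ → Region n → Region n
(s • A) p = ∃[ a ] A a × p ≡ map (s ℚ.*_) a

Δ : ∀ n → Region n
Δ n = conv (λ p → ∃[ i ] p ≡ replicate n 0ℚ [ i ]≔ 1ℚ)

∇ : ∀ n → Region n
∇ n = (ℚ.- 1ℚ) • Δ n

IsBase : ∀ {n} → Matroid n → Vec ℤ n → Set
IsBase M x =
  sumℤ (lookup x) ≡ + rank ×
  (∀ S → sumℤ (λ i → if lookup S i then lookup x i else + 0) ℤ.≤ + r S)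
  where open Matroid M

P : ∀ {n} → Matroid n → Region n
P M = conv (λ p → ∃[ x ] IsBase M x × p ≡ map fromℤ x)

HasCardinality : {A : Set} → Pred A 0ℓ → ℕ → Set
HasCardinality {A} S k =
  ∃ λ (xs : List A) → Unique xs × (∀ a → a ∈ xs ⇔ S a) × length xs ≡ k

-- Q = Q_M.  Cardinality is a relation here, and it determines Q uniquely.
IsLatticePointCount : ∀ {n} → Matroid n → (ℕ → ℕ → ℕ) → Set
IsLatticePointCount {n} M Q = ∀ t u →
  HasCardinality
    (λ (z : Vec ℤ n) → (P M ⊕ fromℕ u • Δ n ⊕ fromℕ t • ∇ n) (map fromℤ z))
    (Q t u)

-- Coefficients c i j with Q(t,u) = Σᵢⱼ c i j (u choose j) (t choose i).  Every
-- polynomial in t and u has exactly one such expansion, up to zero padding.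
IsBinomialExpansion : (ℕ → ℕ → ℕ) → ∀ {d} → (Fin d → Fin d → ℚ) → Set
IsBinomialExpansion Q c = ∀ t u →
  fromℕ (Q t u) ≡
  sumℚ (λ i → sumℚ (λ j →
    c i j ℚ.* fromℕ (u C toℕ j) ℚ.* fromℕ (t C toℕ i)))

-- R ranges over commutative ℚ-algebras, with structure map ι.
module Evaluation {a ℓ} (R : CommutativeRing a ℓ)
                  (ι : ℚ → CommutativeRing.Carrier R) where

  open CommutativeRing R
  open Exp semiring using (_^_) public
  open MonoidSum +-monoid using (sum)

  IsAlgebraMap : Set ℓ
  IsAlgebraMap = IsRingHomomorphism ι
    where open Morphism.RingMorphisms ℚ.+-*-rawRing rawRing

  sumSubsets : ∀ {n} → (Subset n → Carrier) → Carrier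
  sumSubsets {zero}  f = f []
  sumSubsets {suc n} f =
    sumSubsets (λ S → f (outside ∷ S)) + sumSubsets (λ S → f (inside ∷ S))

  -- The truncated subtractions are exact, as r S ≤ rank and r S ≤ ∣ S ∣.
  tutte : ∀ {n} → Matroid n → Carrier → Carrier → Carrier
  tutte M x y = sumSubsets λ S →
    (x - 1#) ^ (rank ℕ.∸ r S) * (y - 1#) ^ (∣ S ∣ ℕ.∸ r S)
    where open Matroid M

  Q′ : ∀ {d} → (Fin d → Fin d → ℚ) → Carrier → Carrier → Carrier
  Q′ c x y = sum (λ i → sum (λ j →
    ι (c i j) * (x - 1#) ^ toℕ i * (y - 1#) ^ toℕ j))

{-# OPTIONS --safe #-}
-- For z ∈ ℤᴱ let A be the set of positive coordinates of z, and put
--   excess z     = (sum of the positive coordinates) - r A,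
--   deficiency z = (minus the sum of the negative coordinates) + r E - r A,
-- both of which are natural numbers.  Then z lies in P(M) + uΔ + t∇ iff
-- (t , u) = (deficiency z + k , excess z + k) for some k ≥ 0.  Hence
--   Q(t,u) + Σ_{s<t} Q(s,u) + Σ_{s<u} Q(t,s)
--     = #{z : deficiency z ≤ t, excess z ≤ u},
-- and sorting the right-hand side by A = S turns it into
--   Σ_S ((|E∖S| - corank S + t) choose |E∖S|) ((r S + u) choose |S|).
-- The umbral map (t choose i)(u choose j) ↦ (x-1)ⁱ(y-1)ʲ turns summation over
-- s<t and over s<u into multiplication by x-1 and y-1.  It therefore sends the
-- left-hand side to (x+y-1) Q′(x,y), and the summand of S to
-- (x-1)^corank x^(|E∖S|-corank) (y-1)^nullity y^(r S).
module Submission where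

open import Defs
open import Algebra.Bundles using (CommutativeMonoid; CommutativeRing)
import Algebra.Morphism.Structures as Morphism
import Algebra.Properties.AbelianGroup as AbelianGroupProperties
import Algebra.Properties.CommutativeSemigroup as CommutativeSemigroupProperties
import Algebra.Properties.CommutativeSemiring.Exp as CommutativeExp
import Algebra.Properties.Monoid.Sum as MonoidSum
import Algebra.Properties.Ring as RingProperties
import Algebra.Properties.Semiring.Exp as Exp
import Algebra.Properties.Semiring.Sum as SemiringSum
import Algebra.Solver.Ring.NaturalCoefficients.Default as SemiringSolver
open import Data.Bool.Base using (Bool; true; false; if_then_else_)
open import Data.Empty using (⊥-elim)
open import Data.Fin.Base as Fin using (Fin; toℕ)
open import Data.Fin.Subset
  using (Subset; inside; outside; ∣_∣; ∁; ⊤; ⊥; _⊆_; _∪_; _∩_)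
import Data.Fin.Subset.Properties as Subsetₚ
open import Data.Integer.Base as ℤ using (ℤ; +[1+_]; -[1+_])
import Data.Integer.Properties as ℤₚ
import Data.Integer.Tactic.RingSolver as ℤSolver
open import Data.List.Base as List using (List; []; _∷_; length)
open import Data.List.Membership.Propositional using (_∈_)
open import Data.List.Membership.Propositional.Properties
  using (∈-++⁺ˡ; ∈-++⁺ʳ; ∈-++⁻; ∈-map⁺; ∈-map⁻; ∈-∃++)
open import Data.List.Properties using (length-++; length-map)
import Data.List.Relation.Unary.All as All
import Data.List.Relation.Unary.AllPairs as AllPairs
open import Data.List.Relation.Unary.Any using (here; there)
open import Data.List.Relation.Unary.Unique.Propositional using (Unique)
import Data.List.Relation.Unary.Unique.Propositional.Properties as Unique
open import Data.Nat.Base as ℕ using (ℕ; zero; suc; z≤n; s≤s; NonZero; _∸_)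
open import Data.Nat.Combinatorics using (_C_; nCk+nC[k+1]≡[n+1]C[k+1]; k>n⇒nCk≡0)
import Data.Nat.Properties as ℕₚ
import Data.Nat.Tactic.RingSolver as ℕSolver
open import Data.Product using (∃-syntax; _×_; _,_; proj₁; proj₂)
open import Data.Rational.Base as ℚ using (ℚ; 0ℚ; 1ℚ)
import Data.Rational.Properties as ℚₚ
open import Data.Rational.Unnormalised.Base as ℚᵘ using (mkℚᵘ)
import Data.Rational.Unnormalised.Properties as ℚᵘₚ
open import Data.Sum using (_⊎_; inj₁; inj₂; map₁)
open import Data.Vec.Base as Vec
  using (Vec; []; _∷_; map; zipWith; lookup; tabulate; replicate; _[_]≔_)
open import Data.Vec.Properties
  using (∷-injectiveˡ; ∷-injectiveʳ; lookup∘tabulate; tabulate∘lookup; tabulate-cong;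
         lookup-map; lookup-zipWith; lookup-replicate; map-cong; map-∘)
open import Function.Base using (_∘_)
open import Function.Bundles using (mk⇔; Equivalence)
open import Level using (0ℓ)
open import Relation.Binary.Definitions using (tri<; tri≈; tri>)
import Relation.Binary.PropositionalEquality as ≡
open ≡ using (_≡_)
import Relation.Binary.Reasoning.Setoid as SetoidReasoning
open import Relation.Nullary using (¬_)
open import Relation.Unary using (Pred)

-- The umbral map is realised on functions instead of polynomials. The coefficients of a function in
-- the binomial basis are its iterated forward differences at 0, so the map is a truncated Newton
-- series, eventually constant in the truncation order for every function with a finite expansion.
-- Comparing two values of one such series then replaces comparing coefficients. The parameter k
-- arises because the coordinate sum of z fixes u - t, while Δ + ∇ contains 0: a point that occurs
-- at (t , u) occurs again at (t + 1 , u + 1). A single Q(t,u) therefore couples its conditions on t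
-- and u. Summing over the two outer borders of a rectangle uncouples them into deficiency z ≤ t and
-- excess z ≤ u, and this independence is what makes the count for each S a product. The factor
-- x+y-1 is 1 + (x-1) + (y-1), one term for the corner and one for each border.

-- Newton series in one and two variables

module NewtonSeries {a ℓ} (R : CommutativeRing a ℓ) where

  open CommutativeRing R
  open RingProperties ring using (-‿distribʳ-*)
  open AbelianGroupProperties +-abelianGroup using (⁻¹-∙-comm)
  open CommutativeSemigroupProperties +-commutativeSemigroup
    using () renaming (interchange to +-interchange)
  open CommutativeSemigroupProperties *-commutativeSemigroup
    using () renaming (x∙yz≈y∙xz to x*yz≈y*xz)
  open MonoidSum +-monoid using (sum)
  open SetoidReasoning setoid

  -- The truncated Newton series Σ_{i<N} (Δⁱ f)(0) Xⁱ, Δ being the forward difference.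
  newton : Carrier → ℕ → (ℕ → Carrier) → Carrier
  newton X zero    f = 0#
  newton X (suc N) f = f 0 + X * newton X N (λ k → f (suc k) - f k)

  newton-cong : ∀ X N {f g} → (∀ k → f k ≈ g k) → newton X N f ≈ newton X N g
  newton-cong X zero    f≈g = refl
  newton-cong X (suc N) f≈g = +-cong (f≈g 0) (*-congˡ
    (newton-cong X N (λ k → +-cong (f≈g (suc k)) (-‿cong (f≈g k)))))

  newton-+ : ∀ X N f g →
    newton X N (λ k → f k + g k) ≈ newton X N f + newton X N g
  newton-+ X zero    f g = sym (+-identityˡ 0#)
  newton-+ X (suc N) f g = begin
    f 0 + g 0 + X * newton X N (λ k → f (suc k) + g (suc k) - (f k + g k))
      ≈⟨ +-congˡ (*-congˡ (newton-cong X N λ k →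
           trans (+-congˡ (sym (⁻¹-∙-comm (f k) (g k)))) (+-interchange _ _ _ _))) ⟩
    f 0 + g 0 + X * newton X N (λ k → (f (suc k) - f k) + (g (suc k) - g k))
      ≈⟨ +-congˡ (trans (*-congˡ (newton-+ X N _ _)) (distribˡ X _ _)) ⟩
    f 0 + g 0 + (X * newton X N (λ k → f (suc k) - f k) +
                 X * newton X N (λ k → g (suc k) - g k))
      ≈⟨ +-interchange _ _ _ _ ⟩
    newton X (suc N) f + newton X (suc N) g ∎

  newton-* : ∀ X N c f → newton X N (λ k → c * f k) ≈ c * newton X N f
  newton-* X zero    c f = sym (zeroʳ c)
  newton-* X (suc N) c f = begin
    c * f 0 + X * newton X N (λ k → c * f (suc k) - c * f k)
      ≈⟨ +-congˡ (*-congˡ (newton-cong X N λ k →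
           trans (+-congˡ (-‿distribʳ-* c (f k))) (sym (distribˡ c _ _)))) ⟩
    c * f 0 + X * newton X N (λ k → c * (f (suc k) - f k))
      ≈⟨ +-congˡ (trans (*-congˡ (newton-* X N c _)) (x*yz≈y*xz X c _)) ⟩
    c * f 0 + c * (X * newton X N (λ k → f (suc k) - f k))
      ≈⟨ distribˡ c _ _ ⟨
    c * newton X (suc N) f ∎

  newton-0 : ∀ X N → newton X N (λ _ → 0#) ≈ 0#
  newton-0 X N = begin
    newton X N (λ _ → 0#)      ≈⟨ newton-cong X N (λ _ → zeroˡ 0#) ⟨
    newton X N (λ _ → 0# * 0#) ≈⟨ newton-* X N 0# (λ _ → 0#) ⟩
    0# * newton X N (λ _ → 0#) ≈⟨ zeroˡ _ ⟩
    0#                         ∎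

  -- A relation, so that it covers both the partial sums of a count and the binomial columns, where
  -- Pascal's rule makes one column the sum of the previous one.
  record _IsSumOf_ (g f : ℕ → Carrier) : Set ℓ where
    field
      initial : g 0 ≈ 0#
      increment  : ∀ k → g (suc k) ≈ g k + f k

  -- The differences of `g` are `f` and its initial value vanishes, so splitting off the first term
  -- of the series of `g` leaves exactly one factor `X`, at the cost of one order of truncation.
  newton-sum : ∀ X N {g f} → g IsSumOf f → newton X (suc N) g ≈ X * newton X N f
  newton-sum X N {g} {f} g-sum-f = begin
    g 0 + X * newton X N (λ k → g (suc k) - g k)
      ≈⟨ +-cong initial (*-congˡ (newton-cong X N λ k → begin
           g (suc k) - g k     ≈⟨ +-congʳ (trans (increment k) (+-comm _ _)) ⟩
           (f k + g k) - g k   ≈⟨ +-assoc _ _ _ ⟩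
           f k + (g k - g k)   ≈⟨ +-congˡ (-‿inverseʳ (g k)) ⟩
           f k + 0#            ≈⟨ +-identityʳ _ ⟩
           f k                 ∎)) ⟩
    0# + X * newton X N f
      ≈⟨ +-identityˡ _ ⟩
    X * newton X N f ∎
    where open _IsSumOf_ g-sum-f

  -- The threshold stands in for a degree bound: the value is required only once the truncation is
  -- long enough, so functions of different degrees can be added.
  Series : Carrier → (ℕ → Carrier) → Carrier → Set ℓ
  Series X f v = ∃[ N₀ ] (∀ {N} → N₀ ℕ.≤ N → newton X N f ≈ v)

  series-cong : ∀ {X f g v w} → (∀ k → f k ≈ g k) → v ≈ w →
    Series X f v → Series X g w
  series-cong {X} f≈g v≈w (N₀ , p) =
    N₀ , λ {N} N₀≤N → trans (newton-cong X N (λ k → sym (f≈g k))) (trans (p N₀≤N) v≈w)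

  series-+ : ∀ {X f g v w} → Series X f v → Series X g w →
    Series X (λ k → f k + g k) (v + w)
  series-+ {X} (N₀ , p) (M₀ , q) = N₀ ℕ.+ M₀ , λ {N} ≤N →
    trans (newton-+ X N _ _)
      (+-cong (p (ℕₚ.m+n≤o⇒m≤o N₀ ≤N)) (q (ℕₚ.m+n≤o⇒n≤o N₀ ≤N)))

  series-const : ∀ {X} c → Series X (λ _ → c) c
  series-const {X} c = 1 , λ { {suc N} (s≤s _) → begin
    c + X * newton X N (λ _ → c - c) ≈⟨ +-congˡ (*-congˡ (newton-cong X N (λ _ → -‿inverseʳ c))) ⟩
    c + X * newton X N (λ _ → 0#)    ≈⟨ +-congˡ (trans (*-congˡ (newton-0 X N)) (zeroʳ X)) ⟩
    c + 0#                           ≈⟨ +-identityʳ c ⟩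
    c                                ∎ }

  series-sum : ∀ {X g f v} → g IsSumOf f → Series X f v → Series X g (X * v)
  series-sum {X} g-sum-f (N₀ , p) =
    suc N₀ , λ { {suc N} (s≤s N₀≤N) → trans (newton-sum X N g-sum-f) (*-congˡ (p N₀≤N)) }

  Series₂ : Carrier → Carrier → (ℕ → ℕ → Carrier) → Carrier → Set ℓ
  Series₂ X Y f v = ∃[ N₀ ] (∀ {M N} → N₀ ℕ.≤ M → N₀ ℕ.≤ N →
    newton X M (λ t → newton Y N (f t)) ≈ v)

  module _ {X Y : Carrier} where

    series₂-cong : ∀ {f g v w} → (∀ t u → f t u ≈ g t u) → v ≈ w →
      Series₂ X Y f v → Series₂ X Y g w
    series₂-cong f≈g v≈w (N₀ , p) = N₀ , λ {M} {N} ≤M ≤N →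
      trans (newton-cong X M (λ t → newton-cong Y N (λ u → sym (f≈g t u))))
        (trans (p ≤M ≤N) v≈w)

    -- Both values equal the truncation taken beyond both thresholds. This is the uniqueness of
    -- binomial expansions in the form in which it is used.
    series₂-unique : ∀ {f v w} → Series₂ X Y f v → Series₂ X Y f w → v ≈ w
    series₂-unique (N₀ , p) (M₀ , q) =
      trans (sym (p ≤₁ ≤₁)) (q ≤₂ ≤₂)
      where
      ≤₁ = ℕₚ.m≤m+n N₀ M₀
      ≤₂ = ℕₚ.m≤n+m M₀ N₀

    series₂-+ : ∀ {f g v w} → Series₂ X Y f v → Series₂ X Y g w →
      Series₂ X Y (λ t u → f t u + g t u) (v + w)
    series₂-+ (N₀ , p) (M₀ , q) = N₀ ℕ.+ M₀ , λ {M} {N} ≤M ≤N →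
      trans (newton-cong X M (λ t → newton-+ Y N _ _)) (trans (newton-+ X M _ _)
        (+-cong (p (ℕₚ.m+n≤o⇒m≤o N₀ ≤M) (ℕₚ.m+n≤o⇒m≤o N₀ ≤N))
                (q (ℕₚ.m+n≤o⇒n≤o N₀ ≤M) (ℕₚ.m+n≤o⇒n≤o N₀ ≤N))))

    series₂-0 : Series₂ X Y (λ _ _ → 0#) 0#
    series₂-0 = 0 , λ {M} {N} _ _ → trans (newton-cong X M (λ _ → newton-0 Y N)) (newton-0 X M)

    series₂-* : ∀ {f g v w} → Series X f v → Series Y g w →
      Series₂ X Y (λ t u → f t * g u) (v * w)
    series₂-* {f} {g} {v} {w} (N₀ , p) (M₀ , q) = N₀ ℕ.+ M₀ , λ {M} {N} ≤M ≤N → begin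
      newton X M (λ t → newton Y N (λ u → f t * g u))
        ≈⟨ newton-cong X M (λ t → newton-* Y N (f t) g) ⟩
      newton X M (λ t → f t * newton Y N g)
        ≈⟨ newton-cong X M (λ t → trans (*-congˡ (q (ℕₚ.m+n≤o⇒n≤o N₀ ≤N))) (*-comm (f t) w)) ⟩
      newton X M (λ t → w * f t)
        ≈⟨ newton-* X M w f ⟩
      w * newton X M f
        ≈⟨ *-congˡ (p (ℕₚ.m+n≤o⇒m≤o N₀ ≤M)) ⟩
      w * v
        ≈⟨ *-comm w v ⟩
      v * w ∎

    series₂-∑ : ∀ {d} {f : Fin d → ℕ → ℕ → Carrier} {v} →
      (∀ i → Series₂ X Y (f i) (v i)) →
      Series₂ X Y (λ t u → sum (λ i → f i t u)) (sum v)
    series₂-∑ {zero}  p = series₂-0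
    series₂-∑ {suc d} p = series₂-+ (p Fin.zero) (series₂-∑ (λ i → p (Fin.suc i)))

    -- By linearity the inner series in u turns a sum over t into a sum over t, and the one-variable
    -- rule applies to the outer series.
    series₂-sumˡ : ∀ {g f v} → (∀ u → (λ t → g t u) IsSumOf (λ t → f t u)) →
      Series₂ X Y f v → Series₂ X Y g (X * v)
    series₂-sumˡ {g} {f} g-sum-f (N₀ , p) = suc N₀ , λ { {suc M} {N} (s≤s ≤M) ≤N →
      trans (newton-sum X M (record
        { initial = trans (newton-cong Y N (λ u → initial (g-sum-f u))) (newton-0 Y N)
        ; increment  = λ t → trans (newton-cong Y N (λ u → increment (g-sum-f u) t))
                              (newton-+ Y N (g t) (f t)) }))
        (*-congˡ (p ≤M (ℕₚ.≤-trans (ℕₚ.n≤1+n N₀) ≤N))) }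
      where open _IsSumOf_

    series₂-sumʳ : ∀ {g f v} → (∀ t → g t IsSumOf f t) →
      Series₂ X Y f v → Series₂ X Y g (Y * v)
    series₂-sumʳ g-sum-f (N₀ , p) = suc N₀ , λ { {M} {suc N} ≤M (s≤s ≤N) →
      trans (newton-cong X M (λ t → newton-sum Y N (g-sum-f t)))
        (trans (newton-* X M Y _) (*-congˡ (p (ℕₚ.≤-trans (ℕₚ.n≤1+n N₀) ≤M) ≤N))) }

-- Cardinalities of finite sets of vectors

module Cardinality where

  open ≡ hiding ([_])
  open import Data.Nat.Base using (_+_; _≤_; _<_)
  open ℕₚ
  open import Data.List.Base using (_++_)

  -- Induction by deleting one occurrence of the head from `ys`: the tail does not contain the head,
  -- so it still embeds in what remains.
  Unique-⊆⇒length≤ : ∀ {A : Set} {xs ys : List A} → Unique xs →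
    (∀ {x} → x ∈ xs → x ∈ ys) → length xs ≤ length ys
  Unique-⊆⇒length≤ {xs = []}     _ _ = z≤n
  Unique-⊆⇒length≤ {xs = x ∷ xs} (x∉xs AllPairs.∷ u) xs⊆ys
    with as , bs , refl ← ∈-∃++ (xs⊆ys (here refl)) = begin
      suc (length xs)              ≤⟨ s≤s (Unique-⊆⇒length≤ u sub) ⟩
      suc (length (as ++ bs))      ≡⟨ cong suc (length-++ as) ⟩
      suc (length as + length bs)  ≡⟨ +-suc (length as) (length bs) ⟨
      length as + suc (length bs)  ≡⟨ length-++ as ⟨
      length (as ++ x ∷ bs)        ∎
    where
    open ≤-Reasoning
    sub : ∀ {y} → y ∈ xs → y ∈ as ++ bs
    sub y∈xs with ∈-++⁻ as (xs⊆ys (there y∈xs))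
    ... | inj₁ y∈as         = ∈-++⁺ˡ y∈as
    ... | inj₂ (here y≡x)   = ⊥-elim (All.lookup x∉xs y∈xs (sym y≡x))
    ... | inj₂ (there y∈bs) = ∈-++⁺ʳ as y∈bs

  module _ {A : Set} where

    card-unique : ∀ {S : Pred A 0ℓ} {k l} → HasCardinality S k → HasCardinality S l → k ≡ l
    card-unique (xs , uxs , xs⇔S , refl) (ys , uys , ys⇔S , refl) = ≤-antisym
      (Unique-⊆⇒length≤ uxs (λ {x} → Equivalence.from (ys⇔S x) ∘ Equivalence.to (xs⇔S x)))
      (Unique-⊆⇒length≤ uys (λ {x} → Equivalence.from (xs⇔S x) ∘ Equivalence.to (ys⇔S x)))

    card-cong : ∀ {S T : Pred A 0ℓ} {k} → (∀ {a} → S a → T a) → (∀ {a} → T a → S a) →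
      HasCardinality S k → HasCardinality T k
    card-cong S⊆T T⊆S (xs , u , xs⇔S , len) = xs , u ,
      (λ a → mk⇔ (S⊆T ∘ Equivalence.to (xs⇔S a)) (Equivalence.from (xs⇔S a) ∘ T⊆S)) , len

    card-∅ : ∀ {S : Pred A 0ℓ} → (∀ {a} → ¬ S a) → HasCardinality S 0
    card-∅ S-empty = [] , AllPairs.[] , (λ a → mk⇔ (λ ()) (⊥-elim ∘ S-empty)) , refl

    card-singleton : (a : A) → HasCardinality (a ≡_) 1
    card-singleton a = a ∷ [] , All.[] AllPairs.∷ AllPairs.[] ,
      (λ b → mk⇔ (λ { (here b≡a) → sym b≡a ; (there ()) }) (λ a≡b → here (sym a≡b))) , refl

    card-⊎ : ∀ {S T : Pred A 0ℓ} {k l} → (∀ {a} → S a → ¬ T a) →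
      HasCardinality S k → HasCardinality T l → HasCardinality (λ a → S a ⊎ T a) (k + l)
    card-⊎ {S} {T} disj (xs , uxs , xs⇔S , refl) (ys , uys , ys⇔T , refl) =
      xs ++ ys ,
      Unique.++⁺ uxs uys (λ {a} (a∈xs , a∈ys) →
        disj (Equivalence.to (xs⇔S a) a∈xs) (Equivalence.to (ys⇔T a) a∈ys)) ,
      (λ a → mk⇔ (to a) (from a)) ,
      length-++ xs
      where
      to : ∀ a → a ∈ xs ++ ys → S a ⊎ T a
      to a a∈ with ∈-++⁻ xs a∈
      ... | inj₁ a∈xs = inj₁ (Equivalence.to (xs⇔S a) a∈xs)
      ... | inj₂ a∈ys = inj₂ (Equivalence.to (ys⇔T a) a∈ys)
      from : ∀ a → S a ⊎ T a → a ∈ xs ++ ys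
      from a (inj₁ Sa) = ∈-++⁺ˡ (Equivalence.from (xs⇔S a) Sa)
      from a (inj₂ Ta) = ∈-++⁺ʳ xs (Equivalence.from (ys⇔T a) Ta)

  sumBelow : (ℕ → ℕ) → ℕ → ℕ
  sumBelow f zero    = 0
  sumBelow f (suc n) = sumBelow f n + f n

  sumOverSubsets : ∀ {n} → (Subset n → ℕ) → ℕ
  sumOverSubsets {zero}  f = f []
  sumOverSubsets {suc n} f =
    sumOverSubsets (f ∘ (outside ∷_)) + sumOverSubsets (f ∘ (inside ∷_))

  card-image : ∀ {A B : Set} {S : Pred A 0ℓ} {k} (f : A → B) →
    (∀ {a b} → f a ≡ f b → a ≡ b) → HasCardinality S k →
    HasCardinality (λ b → ∃[ a ] S a × b ≡ f a) k
  card-image f f-inj (xs , u , xs⇔S , refl) =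
    List.map f xs , Unique.map⁺ f-inj u ,
    (λ b → mk⇔
      (λ b∈ → let a , a∈ , b≡ = ∈-map⁻ f b∈ in a , Equivalence.to (xs⇔S a) a∈ , b≡)
      (λ { (a , Sa , refl) → ∈-map⁺ f (Equivalence.from (xs⇔S a) Sa) })) ,
    length-map f xs

  card-sumBelow : ∀ {A : Set} {S : ℕ → Pred A 0ℓ} {k : ℕ → ℕ} →
    (∀ {i j a} → S i a → S j a → i ≡ j) → (∀ i → HasCardinality (S i) (k i)) →
    ∀ n → HasCardinality (λ a → ∃[ i ] i < n × S i a) (sumBelow k n)
  card-sumBelow disj card zero = card-∅ (λ ())
  card-sumBelow {S = S} disj card (suc n) = card-cong
    (λ { (inj₁ (i , i<n , Sa)) → i , m≤n⇒m≤1+n i<n , Sa ; (inj₂ Sa) → n , ≤-refl , Sa })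
    split
    (card-⊎ (λ { (i , i<n , Sia) Sna → <-irrefl (disj Sia Sna) i<n })
      (card-sumBelow disj card n) (card n))
    where
    split : ∀ {a} → ∃[ i ] i < suc n × S i a → (∃[ i ] i < n × S i a) ⊎ S n a
    split (i , s≤s i≤n , Sa) with m≤n⇒m<n∨m≡n i≤n
    ... | inj₁ i<n  = inj₁ (i , i<n , Sa)
    ... | inj₂ refl = inj₂ Sa

  card-sumOverSubsets : ∀ {A : Set} {n} {S : Subset n → Pred A 0ℓ} {k : Subset n → ℕ} →
    (∀ {X Y a} → S X a → S Y a → X ≡ Y) → (∀ X → HasCardinality (S X) (k X)) →
    HasCardinality (λ a → ∃[ X ] S X a) (sumOverSubsets k)
  card-sumOverSubsets {n = zero} disj card =
    card-cong ([] ,_) (λ { ([] , Sa) → Sa }) (card [])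
  card-sumOverSubsets {n = suc n} disj card = card-cong
    (λ { (inj₁ (X , Sa)) → outside ∷ X , Sa ; (inj₂ (X , Sa)) → inside ∷ X , Sa })
    (λ { (outside ∷ X , Sa) → inj₁ (X , Sa) ; (inside ∷ X , Sa) → inj₂ (X , Sa) })
    (card-⊎ (λ { (X , Sa) (Y , Ta) → case-≢ (disj Sa Ta) })
      (card-sumOverSubsets (λ Sa Ta → cong Vec.tail (disj Sa Ta)) (card ∘ (outside ∷_)))
      (card-sumOverSubsets (λ Sa Ta → cong Vec.tail (disj Sa Ta)) (card ∘ (inside ∷_))))
    where
    case-≢ : ∀ {X Y : Subset n} → outside ∷ X ≢ inside ∷ Y
    case-≢ ()

open Cardinality

-- The ordered ring embedding of the integers into ℚ

toℚᵘ-fromℤ : ∀ i → ℚ.toℚᵘ (fromℤ i) ℚᵘ.≃ mkℚᵘ i 0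
toℚᵘ-fromℤ i = ℚₚ.toℚᵘ-fromℚᵘ (mkℚᵘ i 0)

fromℤ-+ : ∀ i j → fromℤ (i ℤ.+ j) ≡ fromℤ i ℚ.+ fromℤ j
fromℤ-+ i j = ℚₚ.toℚᵘ-injective (begin
  ℚ.toℚᵘ (fromℤ (i ℤ.+ j))                  ≈⟨ toℚᵘ-fromℤ (i ℤ.+ j) ⟩
  mkℚᵘ (i ℤ.+ j) 0
    ≡⟨ ≡.cong (λ k → mkℚᵘ k 0) (≡.cong₂ ℤ._+_ (ℤₚ.*-identityʳ i) (ℤₚ.*-identityʳ j)) ⟨
  mkℚᵘ i 0 ℚᵘ.+ mkℚᵘ j 0                    ≈⟨ ℚᵘₚ.+-cong (toℚᵘ-fromℤ i) (toℚᵘ-fromℤ j) ⟨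
  ℚ.toℚᵘ (fromℤ i) ℚᵘ.+ ℚ.toℚᵘ (fromℤ j)    ≈⟨ ℚₚ.toℚᵘ-homo-+ (fromℤ i) (fromℤ j) ⟨
  ℚ.toℚᵘ (fromℤ i ℚ.+ fromℤ j)              ∎)
  where open SetoidReasoning ℚᵘₚ.≃-setoid

fromℤ-* : ∀ i j → fromℤ (i ℤ.* j) ≡ fromℤ i ℚ.* fromℤ j
fromℤ-* i j = ℚₚ.toℚᵘ-injective (begin
  ℚ.toℚᵘ (fromℤ (i ℤ.* j))                  ≈⟨ toℚᵘ-fromℤ (i ℤ.* j) ⟩
  mkℚᵘ i 0 ℚᵘ.* mkℚᵘ j 0                    ≈⟨ ℚᵘₚ.*-cong (toℚᵘ-fromℤ i) (toℚᵘ-fromℤ j) ⟨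
  ℚ.toℚᵘ (fromℤ i) ℚᵘ.* ℚ.toℚᵘ (fromℤ j)    ≈⟨ ℚₚ.toℚᵘ-homo-* (fromℤ i) (fromℤ j) ⟨
  ℚ.toℚᵘ (fromℤ i ℚ.* fromℤ j)              ∎)
  where open SetoidReasoning ℚᵘₚ.≃-setoid

fromℤ-mono-≤ : ∀ {i j} → i ℤ.≤ j → fromℤ i ℚ.≤ fromℤ j
fromℤ-mono-≤ {i} {j} i≤j = ℚₚ.toℚᵘ-cancel-≤
  (ℚᵘₚ.≤-respˡ-≃ (ℚᵘₚ.≃-sym (toℚᵘ-fromℤ i)) (ℚᵘₚ.≤-respʳ-≃ (ℚᵘₚ.≃-sym (toℚᵘ-fromℤ j))
    (ℚᵘ.*≤* (ℤₚ.*-monoʳ-≤-nonNeg (ℤ.+ 1) i≤j))))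

fromℤ-cancel-≤ : ∀ {i j} → fromℤ i ℚ.≤ fromℤ j → i ℤ.≤ j
fromℤ-cancel-≤ {i} {j} p = ℤₚ.*-cancelʳ-≤-pos i j (ℤ.+ 1) (ℚᵘₚ.drop-*≤*
  (ℚᵘₚ.≤-respˡ-≃ (toℚᵘ-fromℤ i) (ℚᵘₚ.≤-respʳ-≃ (toℚᵘ-fromℤ j) (ℚₚ.toℚᵘ-mono-≤ p))))

fromℕ-+ : ∀ m n → fromℕ (m ℕ.+ n) ≡ fromℕ m ℚ.+ fromℕ n
fromℕ-+ m n = fromℤ-+ (ℤ.+ m) (ℤ.+ n)

fromℕ-* : ∀ m n → fromℕ (m ℕ.* n) ≡ fromℕ m ℚ.* fromℕ n
fromℕ-* m n = ≡.trans (≡.cong fromℤ (ℤₚ.pos-* m n)) (fromℤ-* (ℤ.+ m) (ℤ.+ n))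

-- Rank, nullity and their duals

module _ {n} (M : Matroid n) where

  open Matroid M

  corank : Subset n → ℕ
  corank S = rank ℕ.∸ r S

  nullity : Subset n → ℕ
  nullity S = ∣ S ∣ ℕ.∸ r S

  r+corank : ∀ S → r S ℕ.+ corank S ≡ rank
  r+corank S = ℕₚ.m+[n∸m]≡n (r-monotone (Subsetₚ.⊆⊤))

  r+nullity : ∀ S → r S ℕ.+ nullity S ≡ ∣ S ∣
  r+nullity S = ℕₚ.m+[n∸m]≡n (r-bounded S)

  -- By submodularity, adjoining the complement of `S` raises the rank by at most its size.
  corank≤∣∁∣ : ∀ S → corank S ℕ.≤ ∣ ∁ S ∣
  corank≤∣∁∣ S = ℕₚ.m≤n+o⇒m∸n≤o rank (r S) (begin
    rank                                ≡⟨ ≡.cong r (Subsetₚ.p∪∁p≡⊤ S) ⟨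
    r (S ∪ ∁ S)                         ≤⟨ ℕₚ.m≤m+n _ _ ⟩
    r (S ∪ ∁ S) ℕ.+ r (S ∩ ∁ S)         ≤⟨ r-submod S (∁ S) ⟩
    r S ℕ.+ r (∁ S)                     ≤⟨ ℕₚ.+-monoʳ-≤ (r S) (r-bounded (∁ S)) ⟩
    r S ℕ.+ ∣ ∁ S ∣                     ∎)
    where open ℕₚ.≤-Reasoning

  -- This is the rank of `∁ S` in the dual matroid.
  conullity : Subset n → ℕ
  conullity S = ∣ ∁ S ∣ ℕ.∸ corank S

  corank+conullity : ∀ S → corank S ℕ.+ conullity S ≡ ∣ ∁ S ∣
  corank+conullity S = ℕₚ.m+[n∸m]≡n (corank≤∣∁∣ S)

  -- `n ∸ rank` is the rank of the dual, in which `∁ S` has rank `conullity S` and corank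
  -- `nullity S`; this is `r+corank` for the dual.
  n∸rank : ∀ S → n ℕ.∸ rank ≡ conullity S ℕ.+ nullity S
  n∸rank S = begin
    n ℕ.∸ rank                                 ≡⟨ ≡.cong (ℕ._∸ rank) (≡.sym total) ⟩
    rank ℕ.+ (conullity S ℕ.+ nullity S) ℕ.∸ rank ≡⟨ ℕₚ.m+n∸m≡n rank _ ⟩
    conullity S ℕ.+ nullity S                    ∎
    where
    open ≡.≡-Reasoning
    total : rank ℕ.+ (conullity S ℕ.+ nullity S) ≡ n
    total = begin
      rank ℕ.+ (conullity S ℕ.+ nullity S)
        ≡⟨ ≡.cong (ℕ._+ (conullity S ℕ.+ nullity S)) (r+corank S) ⟨
      r S ℕ.+ corank S ℕ.+ (conullity S ℕ.+ nullity S)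
        ≡⟨ ≡.cong (r S ℕ.+ corank S ℕ.+_) (ℕₚ.+-comm (conullity S) (nullity S)) ⟩
      r S ℕ.+ corank S ℕ.+ (nullity S ℕ.+ conullity S)
        ≡⟨ ℕ-interchange (r S) (corank S) (nullity S) (conullity S) ⟩
      r S ℕ.+ nullity S ℕ.+ (corank S ℕ.+ conullity S)
        ≡⟨ ≡.cong₂ ℕ._+_ (r+nullity S) (≡.trans (corank+conullity S) (Subsetₚ.∣∁p∣≡n∸∣p∣ S)) ⟩
      ∣ S ∣ ℕ.+ (n ℕ.∸ ∣ S ∣)
        ≡⟨ ℕₚ.m+[n∸m]≡n (Subsetₚ.∣p∣≤n S) ⟩
      n ∎
      where open CommutativeSemigroupProperties ℕₚ.+-commutativeSemigroup
              using () renaming (interchange to ℕ-interchange)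

  cellCount : (t u : ℕ) → Subset n → ℕ
  cellCount t u S =
    ((conullity S ℕ.+ t) C ∣ ∁ S ∣) ℕ.* ((r S ℕ.+ u) C ∣ S ∣)

  -- The interface between the two halves of the proof: the algebra takes this identity as its
  -- input, and the geometry of lattice points supplies it.
  CumulativeCount : (ℕ → ℕ → ℕ) → Set
  CumulativeCount Q = ∀ t u →
    Q t u ℕ.+ (sumBelow (λ s → Q s u) t ℕ.+ sumBelow (Q t) u) ≡
      sumOverSubsets (cellCount t u)

-- From the cumulative count to the Tutte polynomial

module _ {a ℓ} (R : CommutativeRing a ℓ) (ι : ℚ → CommutativeRing.Carrier R)
         (ι-hom : Evaluation.IsAlgebraMap R ι) where

  open CommutativeRing R
  open Evaluation R ι
  open NewtonSeries R
  open Exp semiring using (^-homo-*; ^-congˡ)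
  open CommutativeExp commutativeSemiring using (^-distrib-*)
  open SemiringSum semiring using (sum; sum-cong-≋)
  open CommutativeSemigroupProperties *-commutativeSemigroup
    using () renaming (interchange to *-interchange)
  open SemiringSolver commutativeSemiring using (solve; _:+_; _:*_; _:=_; con)
  open Morphism.RingMorphisms ℚ.+-*-rawRing rawRing
  open IsRingHomomorphism ι-hom
    using (⟦⟧-cong; +-homo; *-homo; 0#-homo; 1#-homo)
  open SetoidReasoning setoid

  nat : ℕ → Carrier
  nat = ι ∘ fromℕ

  nat-+ : ∀ m n → nat (m ℕ.+ n) ≈ nat m + nat n
  nat-+ m n = trans (⟦⟧-cong (fromℕ-+ m n)) (+-homo (fromℕ m) (fromℕ n))

  nat-* : ∀ m n → nat (m ℕ.* n) ≈ nat m * nat n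
  nat-* m n = trans (⟦⟧-cong (fromℕ-* m n)) (*-homo (fromℕ m) (fromℕ n))

  nat-≡ : ∀ {m n} → m ≡ n → nat m ≈ nat n
  nat-≡ = ⟦⟧-cong ∘ ≡.cong fromℕ

  ι-sum : ∀ {n} (f : Fin n → ℚ) → ι (MonoidSum.sum ℚₚ.+-0-monoid f) ≈ sum (ι ∘ f)
  ι-sum {zero}  f = 0#-homo
  ι-sum {suc n} f = trans (+-homo _ _) (+-congˡ (ι-sum (f ∘ Fin.suc)))

  nat-sumOverSubsets : ∀ {n} (f : Subset n → ℕ) →
    nat (sumOverSubsets f) ≈ sumSubsets (nat ∘ f)
  nat-sumOverSubsets {zero}  f = refl
  nat-sumOverSubsets {suc n} f = trans (nat-+ (sumOverSubsets (f ∘ (outside ∷_))) _)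
    (+-cong (nat-sumOverSubsets (f ∘ (outside ∷_))) (nat-sumOverSubsets (f ∘ (inside ∷_))))

  sumSubsets-cong : ∀ {n} {f g : Subset n → Carrier} → (∀ S → f S ≈ g S) →
    sumSubsets f ≈ sumSubsets g
  sumSubsets-cong {zero}  f≈g = f≈g []
  sumSubsets-cong {suc n} f≈g =
    +-cong (sumSubsets-cong (f≈g ∘ (outside ∷_))) (sumSubsets-cong (f≈g ∘ (inside ∷_)))

  *-distribˡ-sumSubsets : ∀ {n} c (f : Subset n → Carrier) →
    c * sumSubsets f ≈ sumSubsets (λ S → c * f S)
  *-distribˡ-sumSubsets {zero}  c f = refl
  *-distribˡ-sumSubsets {suc n} c f = trans (distribˡ c _ _)
    (+-cong (*-distribˡ-sumSubsets c (f ∘ (outside ∷_))) (*-distribˡ-sumSubsets c (f ∘ (inside ∷_))))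

  series₂-sumSubsets : ∀ {n X Y} {f : Subset n → ℕ → ℕ → Carrier} {v} →
    (∀ S → Series₂ X Y (f S) (v S)) →
    Series₂ X Y (λ t u → sumSubsets (λ S → f S t u)) (sumSubsets v)
  series₂-sumSubsets {zero}  p = p []
  series₂-sumSubsets {suc n} p =
    series₂-+ (series₂-sumSubsets (p ∘ (outside ∷_))) (series₂-sumSubsets (p ∘ (inside ∷_)))

  nat-sumBelow : ∀ f → (λ k → nat (sumBelow f k)) IsSumOf (λ k → nat (f k))
  nat-sumBelow f = record
    { initial   = 0#-homo
    ; increment = λ k → nat-+ (sumBelow f k) (f k)
    }

  pascal : ∀ n k → suc n C suc k ≡ n C suc k ℕ.+ n C k
  pascal n k = ≡.trans (≡.sym (nCk+nC[k+1]≡[n+1]C[k+1] n k)) (ℕₚ.+-comm (n C k) _)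

  -- The increments are Pascal's rule. The initial value vanishes because the lower index exceeds
  -- `e`.
  shiftedBinomial-isSum : ∀ e m →
    (λ k → nat ((e ℕ.+ k) C suc (e ℕ.+ m))) IsSumOf (λ k → nat ((e ℕ.+ k) C (e ℕ.+ m)))
  shiftedBinomial-isSum e m = record
    { initial   = trans (nat-≡ (k>n⇒nCk≡0 (s≤s (ℕₚ.+-monoʳ-≤ e z≤n)))) 0#-homo
    ; increment = λ k → trans
        (nat-≡ (≡.trans (≡.cong (_C suc (e ℕ.+ m)) (ℕₚ.+-suc e k)) (pascal (e ℕ.+ k) (e ℕ.+ m))))
        (nat-+ ((e ℕ.+ k) C suc (e ℕ.+ m)) _)
    }

  series-binomial : ∀ X m → Series X (λ k → nat (k C m)) (X ^ m)
  series-binomial X zero    =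
    series-cong (λ k → sym (trans (nat-≡ (≡.refl {x = 1})) 1#-homo)) refl (series-const 1#)
  series-binomial X (suc m) = series-sum (shiftedBinomial-isSum 0 m) (series-binomial X m)

  -- Increasing `e` raises both indices. Pascal's rule splits the new binomial into the old one, of
  -- value v, and its sum over k, of value `X * v`; hence one more factor `1# + X`.
  series-shiftedBinomial : ∀ X m e →
    Series X (λ k → nat ((e ℕ.+ k) C (e ℕ.+ m))) (X ^ m * (1# + X) ^ e)
  series-shiftedBinomial X m zero    =
    series-cong (λ _ → refl) (sym (*-identityʳ _)) (series-binomial X m)
  series-shiftedBinomial X m (suc e) = series-cong
    (λ k → sym (trans (nat-≡ (pascal (e ℕ.+ k) (e ℕ.+ m))) (nat-+ ((e ℕ.+ k) C suc (e ℕ.+ m)) _)))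
    (solve 3 (λ x a b → x :* (a :* b) :+ a :* b := a :* ((con 1 :+ x) :* b)) refl
      X (X ^ m) ((1# + X) ^ e))
    (series-+ (series-sum (shiftedBinomial-isSum e m) p) p)
    where p = series-shiftedBinomial X m e

  -- Each term is a function of t times a function of u, so its value is a product of powers. This
  -- identifies `Q′`, defined through the coefficients, with the Newton series of the counting
  -- function itself.
  series₂-expansion : ∀ Q {d} (c : Fin d → Fin d → ℚ) → IsBinomialExpansion Q c →
    ∀ x y → Series₂ (x - 1#) (y - 1#) (λ t u → nat (Q t u)) (Q′ c x y)
  series₂-expansion Q {d} c expansion x y = series₂-cong
    (λ t u → sym (begin
      nat (Q t u)
        ≈⟨ ⟦⟧-cong (expansion t u) ⟩
      ι (sumℚ λ i → sumℚ λ j → q t u i j)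
        ≈⟨ ι-sum (λ i → sumℚ λ j → q t u i j) ⟩
      sum {d} (λ i → ι (sumℚ λ j → q t u i j))
        ≈⟨ sum-cong-≋ (λ i → trans (ι-sum (q t u i)) (sum-cong-≋ (λ j → begin
             ι (c i j ℚ.* fromℕ (u C toℕ j) ℚ.* fromℕ (t C toℕ i))
               ≈⟨ trans (*-homo _ _) (*-congʳ (*-homo _ _)) ⟩
             ι (c i j) * nat (u C toℕ j) * nat (t C toℕ i)
               ≈⟨ solve 3 (λ a b c → a :* b :* c := a :* c :* b) refl _ _ _ ⟩
             ι (c i j) * nat (t C toℕ i) * nat (u C toℕ j) ∎))) ⟩
      sum {d} (λ i → sum {d} (λ j → ι (c i j) * nat (t C toℕ i) * nat (u C toℕ j))) ∎))
    refl
    (series₂-∑ λ i → series₂-∑ λ j →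
      series₂-* (series-scale (ι (c i j)) (series-binomial _ (toℕ i))) (series-binomial _ (toℕ j)))
    where
    sumℚ : ∀ {k} → (Fin k → ℚ) → ℚ
    sumℚ = MonoidSum.sum ℚₚ.+-0-monoid
    q : ℕ → ℕ → Fin d → Fin d → ℚ
    q t u i j = c i j ℚ.* fromℕ (u C toℕ j) ℚ.* fromℕ (t C toℕ i)
    series-scale : ∀ {X f v} c → Series X f v → Series X (λ k → c * f k) (c * v)
    series-scale {X} c (N₀ , p) = N₀ , λ {N} ≤N → trans (newton-* X N c _) (*-congˡ (p ≤N))

  module _ {n} (M : Matroid n) (x y : Carrier) where

    open Matroid M

    cell : Subset n → Carrier
    cell S = ((x - 1#) ^ corank M S * x ^ conullity M S) *
             ((y - 1#) ^ nullity M S * y ^ r S)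

    1+[z-1] : ∀ z → 1# + (z - 1#) ≈ z
    1+[z-1] z = begin
      1# + (z - 1#)   ≈⟨ +-comm _ _ ⟩
      z - 1# + 1#     ≈⟨ +-assoc _ _ _ ⟩
      z + (- 1# + 1#) ≈⟨ +-congˡ (-‿inverseˡ 1#) ⟩
      z + 0#          ≈⟨ +-identityʳ z ⟩
      z               ∎

    series₂-cell : ∀ S →
      Series₂ (x - 1#) (y - 1#) (λ t u → nat (cellCount M t u S)) (cell S)
    series₂-cell S = series₂-cong
      (λ t u → sym (trans
        (nat-* ((conullity M S ℕ.+ t) C ∣ ∁ S ∣) _)
        (*-cong
          (nat-≡ (≡.cong ((conullity M S ℕ.+ t) C_)
            (≡.trans (≡.sym (corank+conullity M S)) (ℕₚ.+-comm (corank M S) _))))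
          (nat-≡ (≡.cong ((r S ℕ.+ u) C_) (≡.sym (r+nullity M S)))))))
      (*-cong (*-congˡ (^-congˡ (conullity M S) (1+[z-1] x))) (*-congˡ (^-congˡ (r S) (1+[z-1] y))))
      (series₂-* (series-shiftedBinomial (x - 1#) (corank M S) (conullity M S))
                 (series-shiftedBinomial (y - 1#) (nullity M S) (r S)))

    w : Carrier
    w = x + y - 1#

    -- Both sides are values of the Newton series of the cumulative count, read once along the
    -- borders of the rectangle and once cell by cell.
    w*Q′≈cells : ∀ Q → CumulativeCount M Q →
      ∀ {d} (c : Fin d → Fin d → ℚ) → IsBinomialExpansion Q c →
      w * Q′ c x y ≈ sumSubsets cell
    w*Q′≈cells Q count c expansion = series₂-unique
      (series₂-cong
        (λ t u → trans (+-congˡ (sym (nat-+ (sumBelow (λ s → Q s u) t) _)))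
          (trans (sym (nat-+ (Q t u) _))
            (trans (nat-≡ (count t u)) (nat-sumOverSubsets (cellCount M t u)))))
        total
        (series₂-+ q (series₂-+
          (series₂-sumˡ (λ u → nat-sumBelow (λ s → Q s u)) q)
          (series₂-sumʳ (λ t → nat-sumBelow (Q t)) q))))
      (series₂-sumSubsets series₂-cell)
      where
      q = series₂-expansion Q c expansion x y
      total : Q′ c x y + ((x - 1#) * Q′ c x y + (y - 1#) * Q′ c x y) ≈ w * Q′ c x y
      total = begin
        Q′ c x y + ((x - 1#) * Q′ c x y + (y - 1#) * Q′ c x y)
          ≈⟨ solve 3 (λ q a b → q :+ (a :* q :+ b :* q) := (con 1 :+ a :+ b) :* q) refl _ _ _ ⟩
        (1# + (x - 1#) + (y - 1#)) * Q′ c x y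
          ≈⟨ *-congʳ (trans (+-congʳ (1+[z-1] x)) (sym (+-assoc _ _ _))) ⟩
        w * Q′ c x y ∎

    module _ {x⁻¹ y⁻¹ : Carrier} (xx⁻¹≈1 : x * x⁻¹ ≈ 1#) (yy⁻¹≈1 : y * y⁻¹ ≈ 1#) where

      ^-inverse : ∀ {z z⁻¹} → z * z⁻¹ ≈ 1# → ∀ k → z ^ k * z⁻¹ ^ k ≈ 1#
      ^-inverse zz⁻¹≈1 zero    = *-identityˡ 1#
      ^-inverse zz⁻¹≈1 (suc k) = trans (*-interchange _ _ _ _)
        (trans (*-cong zz⁻¹≈1 (^-inverse zz⁻¹≈1 k)) (*-identityˡ 1#))

      w/y-1 : w * y⁻¹ - 1# ≈ (x - 1#) * y⁻¹
      w/y-1 = begin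
        (x + y - 1#) * y⁻¹ - 1#
          ≈⟨ +-congʳ (*-congʳ (trans (+-assoc _ _ _)
               (trans (+-congˡ (+-comm _ _)) (sym (+-assoc _ _ _))))) ⟩
        (x - 1# + y) * y⁻¹ - 1#
          ≈⟨ +-congʳ (trans (distribʳ _ _ _) (+-congˡ yy⁻¹≈1)) ⟩
        (x - 1#) * y⁻¹ + 1# - 1#
          ≈⟨ trans (+-assoc _ _ _) (trans (+-congˡ (-‿inverseʳ 1#)) (+-identityʳ _)) ⟩
        (x - 1#) * y⁻¹ ∎

      w/x-1 : w * x⁻¹ - 1# ≈ (y - 1#) * x⁻¹
      w/x-1 = begin
        (x + y - 1#) * x⁻¹ - 1#
          ≈⟨ +-congʳ (*-congʳ (trans (+-assoc _ _ _) (+-comm _ _))) ⟩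
        (y - 1# + x) * x⁻¹ - 1#
          ≈⟨ +-congʳ (trans (distribʳ _ _ _) (+-congˡ xx⁻¹≈1)) ⟩
        (y - 1#) * x⁻¹ + 1# - 1#
          ≈⟨ trans (+-assoc _ _ _) (trans (+-congˡ (-‿inverseʳ 1#)) (+-identityʳ _)) ⟩
        (y - 1#) * x⁻¹ ∎

      -- The arguments of the Tutte polynomial, reduced by 1, are `(x - 1#) * y⁻¹` and
      -- `(y - 1#) * x⁻¹`. The prefactor splits, for every `S`, into x to the conullity plus nullity
      -- and y to the rank plus corank; the nullity and corank parts cancel the denominators.
      cell-tutte : ∀ S →
        x ^ (n ℕ.∸ rank) * y ^ rank *
          ((w * y⁻¹ - 1#) ^ corank M S * (w * x⁻¹ - 1#) ^ nullity M S) ≈ cell S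
      cell-tutte S = begin
        x ^ (n ℕ.∸ rank) * y ^ rank *
          ((w * y⁻¹ - 1#) ^ k * (w * x⁻¹ - 1#) ^ l)
          ≈⟨ *-cong
               (*-cong (trans (reflexive (≡.cong (x ^_) (n∸rank M S))) (^-homo-* x (conullity M S) l))
                       (trans (reflexive (≡.cong (y ^_) (≡.sym (r+corank M S)))) (^-homo-* y (r S) k)))
               (*-cong (trans (^-congˡ k w/y-1) (^-distrib-* _ _ k))
                       (trans (^-congˡ l w/x-1) (^-distrib-* _ _ l))) ⟩
        (x ^ conullity M S * x ^ l) * (y ^ r S * y ^ k) *
          (((x - 1#) ^ k * y⁻¹ ^ k) * ((y - 1#) ^ l * x⁻¹ ^ l))
          ≈⟨ solve 8 (λ xe xl yr yk X yk′ Y xl′ →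
               (xe :* xl) :* (yr :* yk) :* ((X :* yk′) :* (Y :* xl′)) :=
               ((X :* xe) :* (Y :* yr)) :* ((xl :* xl′) :* (yk :* yk′))) refl _ _ _ _ _ _ _ _ ⟩
        cell S * ((x ^ l * x⁻¹ ^ l) * (y ^ k * y⁻¹ ^ k))
          ≈⟨ *-congˡ (trans (*-cong (^-inverse xx⁻¹≈1 l) (^-inverse yy⁻¹≈1 k)) (*-identityˡ 1#)) ⟩
        cell S * 1#
          ≈⟨ *-identityʳ _ ⟩
        cell S ∎
        where
        k = corank M S
        l = nullity M S

      Q′-tutte : ∀ {w⁻¹} → w * w⁻¹ ≈ 1# →
        ∀ Q → CumulativeCount M Q →
        ∀ {d} (c : Fin d → Fin d → ℚ) → IsBinomialExpansion Q c →
        Q′ c x y ≈ x ^ (n ℕ.∸ rank) * y ^ rank * w⁻¹ * tutte M (w * y⁻¹) (w * x⁻¹)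
      Q′-tutte {w⁻¹} ww⁻¹≈1 Q count c expansion = begin
        Q′ c x y
          ≈⟨ trans (*-congʳ ww⁻¹≈1) (*-identityˡ _) ⟨
        w * w⁻¹ * Q′ c x y
          ≈⟨ solve 3 (λ a b c → a :* b :* c := b :* (a :* c)) refl _ _ _ ⟩
        w⁻¹ * (w * Q′ c x y)
          ≈⟨ *-congˡ (w*Q′≈cells Q count c expansion) ⟩
        w⁻¹ * sumSubsets cell
          ≈⟨ *-congˡ (sumSubsets-cong cell-tutte) ⟨
        w⁻¹ * sumSubsets (λ S → x ^ (n ℕ.∸ rank) * y ^ rank * term S)
          ≈⟨ *-congˡ (*-distribˡ-sumSubsets _ term) ⟨
        w⁻¹ * (x ^ (n ℕ.∸ rank) * y ^ rank * sumSubsets term)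
          ≈⟨ solve 3 (λ a b c → b :* (a :* c) := a :* b :* c) refl _ _ _ ⟩
        x ^ (n ℕ.∸ rank) * y ^ rank * w⁻¹ * tutte M (w * y⁻¹) (w * x⁻¹) ∎
        where
        term : Subset n → Carrier
        term S = (w * y⁻¹ - 1#) ^ corank M S * (w * x⁻¹ - 1#) ^ nullity M S

-- Counting integer vectors by their positive support

module Counting where

  open ≡ hiding ([_])
  open import Data.Nat.Base using (_+_; _*_; _≤_; _<_)
  open ℕₚ

  posPart negPart : ℤ → ℕ
  posPart (ℤ.+ k)    = k
  posPart -[1+ k ] = 0
  negPart (ℤ.+ k)    = 0
  negPart -[1+ k ] = suc k

  isPositive : ℤ → Bool
  isPositive (ℤ.+ zero) = outside
  isPositive +[1+ _ ] = inside
  isPositive -[1+ _ ] = outside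

  pos neg : ∀ {n} → Vec ℤ n → ℕ
  pos []       = 0
  pos (z ∷ zs) = posPart z + pos zs
  neg []       = 0
  neg (z ∷ zs) = negPart z + neg zs

  posSupp : ∀ {n} → Vec ℤ n → Subset n
  posSupp = map isPositive

  -- A positive integer is at least 1. With `r-bounded` this makes the subtraction in `excess`
  -- exact.
  ∣posSupp∣≤pos : ∀ {n} (z : Vec ℤ n) → ∣ posSupp z ∣ ≤ pos z
  ∣posSupp∣≤pos []              = z≤n
  ∣posSupp∣≤pos ((ℤ.+ zero) ∷ zs) = ∣posSupp∣≤pos zs
  ∣posSupp∣≤pos (+[1+ k ] ∷ zs) = s≤s (≤-trans (∣posSupp∣≤pos zs) (m≤n+m _ k))
  ∣posSupp∣≤pos (-[1+ k ] ∷ zs) = ∣posSupp∣≤pos zs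

  -- Bounding neg z + |∁ S| instead of neg z makes both binomials below obey Pascal's
  -- rule in the same way.
  Box : ∀ {n} → Subset n → ℕ → ℕ → Vec ℤ n → Set
  Box S a b z = posSupp z ≡ S × pos z ≤ a × neg z + ∣ ∁ S ∣ ≤ b

  raise lower : ∀ {n} → Vec ℤ (suc n) → Vec ℤ (suc n)
  raise (z ∷ zs) = ℤ.suc z ∷ zs
  lower (z ∷ zs) = ℤ.pred z ∷ zs

  raise-injective : ∀ {n} {z z′ : Vec ℤ (suc n)} → raise z ≡ raise z′ → z ≡ z′
  raise-injective {z = z ∷ zs} {z′ ∷ zs′} eq = cong₂ _∷_
    (trans (sym (ℤₚ.pred-suc z)) (trans (cong ℤ.pred (∷-injectiveˡ eq)) (ℤₚ.pred-suc z′)))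
    (∷-injectiveʳ eq)

  lower-injective : ∀ {n} {z z′ : Vec ℤ (suc n)} → lower z ≡ lower z′ → z ≡ z′
  lower-injective {z = z ∷ zs} {z′ ∷ zs′} eq = cong₂ _∷_
    (trans (sym (ℤₚ.suc-pred z)) (trans (cong ℤ.suc (∷-injectiveˡ eq)) (ℤₚ.suc-pred z′)))
    (∷-injectiveʳ eq)

  card-≡ : ∀ {A : Set} {S : A → Set} {k l} → k ≡ l → HasCardinality S k → HasCardinality S l
  card-≡ refl c = c

  -- Pascal's rule, read on the first coordinate. If it must be positive, either it equals 1 and is
  -- dropped, or it comes from a smaller positive value by `raise`; both cases use up one unit of
  -- `a`. If it must not be positive, 0 and `lower` do the same with `b`.
  card-Box : ∀ {n} (S : Subset n) a b →
    HasCardinality (Box S a b) ((b C ∣ ∁ S ∣) * (a C ∣ S ∣))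
  card-Box [] a b = card-cong
    (λ { refl → refl , z≤n , z≤n }) (λ { {[]} _ → refl }) (card-singleton [])
  card-Box (inside ∷ S) zero b =
    card-≡ (sym (trans (cong ((b C ∣ ∁ S ∣) *_) (k>n⇒nCk≡0 (s≤s (z≤n {∣ S ∣}))))
                       (*-zeroʳ (b C ∣ ∁ S ∣))))
      (card-∅ λ {z} → empty z)
    where
    empty : ∀ z → ¬ Box (inside ∷ S) zero b z
    empty (+[1+ _ ] ∷ _) (_ , () , _)
    empty ((ℤ.+ zero) ∷ _) (() , _)
    empty (-[1+ _ ] ∷ _) (() , _)
  card-Box (inside ∷ S) (suc a) b =
    card-cong to from
      (card-≡ (trans (sym (*-distribˡ-+ (b C ∣ ∁ S ∣) _ _))
                     (cong ((b C ∣ ∁ S ∣) *_) (nCk+nC[k+1]≡[n+1]C[k+1] a ∣ S ∣)))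
        (card-⊎ disj
          (card-image (ℤ.+ 1 ∷_) ∷-injectiveʳ (card-Box S a b))
          (card-image raise raise-injective (card-Box (inside ∷ S) a b))))
    where
    One More : Vec ℤ _ → Set
    One z  = ∃[ z′ ] Box S a b z′ × z ≡ ℤ.+ 1 ∷ z′
    More z = ∃[ z′ ] Box (inside ∷ S) a b z′ × z ≡ raise z′
    disj : ∀ {z} → One z → ¬ More z
    disj (_ , _ , refl) (+[1+ _ ] ∷ _ , _ , ())
    disj (_ , _ , refl) ((ℤ.+ zero) ∷ _ , (() , _) , _)
    disj (_ , _ , refl) (-[1+ _ ] ∷ _ , (() , _) , _)
    to : ∀ {z} → One z ⊎ More z → Box (inside ∷ S) (suc a) b z
    to (inj₁ (_ , (refl , p , q) , refl)) = refl , s≤s p , q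
    to (inj₂ (+[1+ _ ] ∷ _ , (refl , p , q) , refl)) = refl , s≤s p , q
    to (inj₂ ((ℤ.+ zero) ∷ _ , (() , _) , _))
    to (inj₂ (-[1+ _ ] ∷ _ , (() , _) , _))
    from : ∀ {z} → Box (inside ∷ S) (suc a) b z → One z ⊎ More z
    from {+[1+ zero ] ∷ zs}  (refl , s≤s p , q) = inj₁ (zs , (refl , p , q) , refl)
    from {+[1+ suc k ] ∷ zs} (refl , s≤s p , q) = inj₂ (+[1+ k ] ∷ zs , (refl , p , q) , refl)
    from {(ℤ.+ zero) ∷ _} (() , _)
    from { -[1+ _ ] ∷ _} (() , _)
  card-Box (outside ∷ S) a zero =
    card-≡ (sym (cong (_* (a C ∣ S ∣)) (k>n⇒nCk≡0 (s≤s (z≤n {∣ ∁ S ∣})))))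
      (card-∅ λ {z} (_ , _ , q) →
        n≮0 (≤-trans (m≤n+m (suc ∣ ∁ S ∣) (neg z)) q))
  card-Box (outside ∷ S) a (suc b) =
    card-cong to from
      (card-≡ (trans (sym (*-distribʳ-+ (a C ∣ S ∣) (b C ∣ ∁ S ∣) (b C suc ∣ ∁ S ∣)))
                     (cong (_* (a C ∣ S ∣)) (nCk+nC[k+1]≡[n+1]C[k+1] b ∣ ∁ S ∣)))
        (card-⊎ disj
          (card-image (ℤ.+ 0 ∷_) ∷-injectiveʳ (card-Box S a b))
          (card-image lower lower-injective (card-Box (outside ∷ S) a b))))
    where
    Zero Less : Vec ℤ _ → Set
    Zero z = ∃[ z′ ] Box S a b z′ × z ≡ ℤ.+ 0 ∷ z′
    Less z = ∃[ z′ ] Box (outside ∷ S) a b z′ × z ≡ lower z′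
    disj : ∀ {z} → Zero z → ¬ Less z
    disj (_ , _ , refl) (+[1+ _ ] ∷ _ , (() , _) , _)
    disj (_ , _ , refl) ((ℤ.+ zero) ∷ _ , _ , ())
    disj (_ , _ , refl) (-[1+ _ ] ∷ _ , _ , ())
    to : ∀ {z} → Zero z ⊎ Less z → Box (outside ∷ S) a (suc b) z
    to (inj₁ (zs , (refl , p , q) , refl)) =
      refl , p , ≤-trans (≤-reflexive (+-suc (neg zs) _)) (s≤s q)
    to (inj₂ (+[1+ _ ] ∷ _ , (() , _) , _))
    to (inj₂ ((ℤ.+ zero) ∷ zs , (refl , p , q) , refl)) = refl , p , s≤s q
    to (inj₂ (-[1+ k ] ∷ zs , (refl , p , q) , refl)) = refl , p , s≤s q
    from : ∀ {z} → Box (outside ∷ S) a (suc b) z → Zero z ⊎ Less z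
    from {+[1+ _ ] ∷ _} (() , _)
    from {(ℤ.+ zero) ∷ zs} (refl , p , q) =
      inj₁ (zs , (refl , p , ℕ.s≤s⁻¹ (≤-trans (≤-reflexive (sym (+-suc (neg zs) _))) q)) , refl)
    from { -[1+ zero ] ∷ zs}  (refl , p , s≤s q) = inj₂ (ℤ.+ 0 ∷ zs , (refl , p , q) , refl)
    from { -[1+ suc k ] ∷ zs} (refl , p , s≤s q) = inj₂ (-[1+ k ] ∷ zs , (refl , p , q) , refl)

  module _ {n} (M : Matroid n) where

    open Matroid M

    excess deficiency : Vec ℤ n → ℕ
    excess z     = pos z ∸ r (posSupp z)
    deficiency z = neg z + corank M (posSupp z)

    r+excess : ∀ z → r (posSupp z) + excess z ≡ pos z
    r+excess z = m+[n∸m]≡n (≤-trans (r-bounded (posSupp z)) (∣posSupp∣≤pos z))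

    Diagonal Below : ℕ → ℕ → Vec ℤ n → Set
    Diagonal t u z = ∃[ k ] t ≡ deficiency z + k × u ≡ excess z + k
    Below    t u z = deficiency z ≤ t × excess z ≤ u

    -- Adding `r A` to both sides of the bound on the excess, and `conullity A` to both sides of the
    -- bound on the deficiency, gives the two bounds of `Box` for `A = posSupp z`.
    card-Below : ∀ t u → HasCardinality (Below t u) (sumOverSubsets (cellCount M t u))
    card-Below t u = card-cong
      (λ { {z} (_ , refl , p , q) →
        +-cancelˡ-≤ (conullity M (posSupp z)) _ _ (≤-trans (≤-reflexive (sym (eq z))) q) ,
        +-cancelˡ-≤ (r (posSupp z)) _ _ (≤-trans (≤-reflexive (r+excess z)) p) })
      (λ {z} (q , p) → posSupp z , refl ,
        ≤-trans (≤-reflexive (sym (r+excess z))) (+-monoʳ-≤ (r (posSupp z)) p) ,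
        ≤-trans (≤-reflexive (eq z)) (+-monoʳ-≤ (conullity M (posSupp z)) q))
      (card-sumOverSubsets (λ { (refl , _) (refl , _) → refl })
        (λ S → card-Box S (r S + u) (conullity M S + t)))
      where
      rearrange : ∀ a b c → a + (b + c) ≡ c + (a + b)
      rearrange = ℕSolver.solve-∀
      eq : ∀ z → neg z + ∣ ∁ (posSupp z) ∣ ≡ conullity M (posSupp z) + deficiency z
      eq z = trans (cong (neg z +_) (sym (corank+conullity M (posSupp z))))
                   (rearrange (neg z) (corank M (posSupp z)) _)

    -- The pairs at which z is counted form a ray of slope 1 from `(deficiency z , excess z)`. If
    -- the ray starts inside the rectangle with corner (t , u), it leaves through exactly one point
    -- of the two outer borders; otherwise it misses them.
    cumulativeCount : ∀ {Q} → (∀ t u → HasCardinality (Diagonal t u) (Q t u)) →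
      CumulativeCount M Q
    cumulativeCount {Q} card t u = card-unique
      (card-cong to from
        (card-⊎ disj (card t u)
          (card-⊎ disj′
            (card-sumBelow (λ d d′ → proj₁ (unique d d′) refl) (λ s → card s u) t)
            (card-sumBelow (λ d d′ → proj₂ (unique d d′) refl) (λ s → card t s) u))))
      (card-Below t u)
      where
      Column Row : Vec ℤ n → Set
      Column z = ∃[ s ] s < t × Diagonal s u z
      Row z    = ∃[ s ] s < u × Diagonal t s z

      unique : ∀ {t t′ u u′ z} → Diagonal t u z → Diagonal t′ u′ z →
        (u ≡ u′ → t ≡ t′) × (t ≡ t′ → u ≡ u′)
      unique {z = z} (k , refl , refl) (k′ , refl , refl) =
        (λ eq → cong (λ k → deficiency z + k) (+-cancelˡ-≡ (excess z) _ _ eq)) ,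
        (λ eq → cong (λ k → excess z + k) (+-cancelˡ-≡ (deficiency z) _ _ eq))

      disj : ∀ {z} → Diagonal t u z → ¬ (Column z ⊎ Row z)
      disj d (inj₁ (s , s<t , d′)) = <-irrefl (proj₁ (unique d′ d) refl) s<t
      disj d (inj₂ (s , s<u , d′)) = <-irrefl (proj₂ (unique d′ d) refl) s<u

      disj′ : ∀ {z} → Column z → ¬ Row z
      disj′ {z} (s , s<t , k , refl , refl) (s′ , s′<u , k′ , refl , refl) =
        <-asym (+-cancelˡ-< (deficiency z) _ _ s<t) (+-cancelˡ-< (excess z) _ _ s′<u)

      to : ∀ {z} → Diagonal t u z ⊎ (Column z ⊎ Row z) → Below t u z
      to {z} (inj₁ (k , refl , refl)) = m≤m+n _ k , m≤m+n _ k
      to {z} (inj₂ (inj₁ (_ , s<t , k , refl , refl))) =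
        ≤-trans (m≤m+n _ k) (<⇒≤ s<t) , m≤m+n _ k
      to {z} (inj₂ (inj₂ (_ , s<u , k , refl , refl))) =
        m≤m+n _ k , ≤-trans (m≤m+n _ k) (<⇒≤ s<u)

      from : ∀ {z} → Below t u z → Diagonal t u z ⊎ (Column z ⊎ Row z)
      from {z} (q , p) with m≤n⇒∃[o]m+o≡n q | m≤n⇒∃[o]m+o≡n p
      ... | k , refl | l , refl with <-cmp k l
      -- `k` and `l` are the distances from the start of the ray to the borders in t and in u. The
      -- smaller one decides which border is reached, equality being the corner.
      ... | tri< k<l _ _ =
        inj₂ (inj₂ (excess z + k , +-monoʳ-< (excess z) k<l , k , refl , refl))
      ... | tri≈ _ refl _ = inj₁ (k , refl , refl)
      ... | tri> _ _ l<k =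
        inj₂ (inj₁ (deficiency z + l , +-monoʳ-< (deficiency z) l<k , l , refl , refl))

open Counting

-- A base that meets a given set in full rank

module Bases where

  open ≡ hiding ([_])
  open import Data.Nat.Base using (_+_; _≤_)
  open ℕₚ
  open CommutativeSemigroupProperties +-commutativeSemigroup using (interchange)
  open MonoidSum ℤₚ.+-0-monoid using () renaming (sum to sumℤ)

  weight : ∀ {n} → Subset n → Vec ℕ n → ℕ
  weight []            []       = 0
  weight (outside ∷ S) (b ∷ bs) = weight S bs
  weight (inside ∷ S)  (b ∷ bs) = b + weight S bs

  weight-⊥ : ∀ {n} (b : Vec ℕ n) → weight ⊥ b ≡ 0
  weight-⊥ []       = refl
  weight-⊥ (b ∷ bs) = weight-⊥ bs

  weight-∁ : ∀ {n} S (b : Vec ℕ n) → weight S b + weight (∁ S) b ≡ weight ⊤ b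
  weight-∁ []            []       = refl
  weight-∁ (outside ∷ S) (b ∷ bs) = trans (swap (weight S bs) b _) (cong (b +_) (weight-∁ S bs))
    where
    swap : ∀ x y z → x + (y + z) ≡ y + (x + z)
    swap = ℕSolver.solve-∀
  weight-∁ (inside ∷ S)  (b ∷ bs) = trans (+-assoc b _ _) (cong (b +_) (weight-∁ S bs))

  weight-+ : ∀ {n} S (b c : Vec ℕ n) → weight S (zipWith _+_ b c) ≡ weight S b + weight S c
  weight-+ []            []       []       = refl
  weight-+ (outside ∷ S) (b ∷ bs) (c ∷ cs) = weight-+ S bs cs
  weight-+ (inside ∷ S)  (b ∷ bs) (c ∷ cs) =
    trans (cong (b + c +_) (weight-+ S bs cs)) (interchange b c _ _)

  -- No value is prescribed at the empty set, so that contractions stay within the class without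
  -- subtracting a constant.
  record IsPolymatroid {n} (f : Subset n → ℕ) : Set where
    field
      monotone   : ∀ {S T} → S ⊆ T → f S ≤ f T
      submodular : ∀ S T → f (S ∪ T) + f (S ∩ T) ≤ f S + f T

  -- The greedy vertex of the base polytope of f - f ∅.
  greedy : ∀ {n} {f : Subset n → ℕ} → IsPolymatroid f →
    ∃[ b ] (∀ S → weight S b + f ⊥ ≤ f S) × weight ⊤ b + f ⊥ ≡ f ⊤
  greedy {zero} f-poly = [] , (λ { [] → ≤-refl }) , refl
  -- The remaining coordinates are greedy for the contraction of the first element, whose value at
  -- the empty set is `f (inside ∷ ⊥)`.
  greedy {suc n} {f} f-poly with greedy {f = f ∘ (inside ∷_)} record
    { monotone   = monotone ∘ Subsetₚ.s⊆s
    ; submodular = λ S T → submodular (inside ∷ S) (inside ∷ T)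
    } where open IsPolymatroid f-poly
  ... | bs , bounds , total = b ∷ bs , bounds′ , total′
    where
    open IsPolymatroid f-poly
    open ≤-Reasoning

    b : ℕ
    b = f (inside ∷ ⊥) ∸ f (outside ∷ ⊥)

    b+f⊥ : b + f (outside ∷ ⊥) ≡ f (inside ∷ ⊥)
    b+f⊥ = m∸n+n≡m (monotone (Subsetₚ.⊆-min _))

    shift : ∀ w → b + w + f (outside ∷ ⊥) ≡ w + f (inside ∷ ⊥)
    shift w = trans (rearrange b w _) (cong (w +_) b+f⊥)
      where
      rearrange : ∀ x y z → x + y + z ≡ y + (x + z)
      rearrange = ℕSolver.solve-∀

    bounds′ : ∀ S → weight S (b ∷ bs) + f (outside ∷ ⊥) ≤ f S
    bounds′ (inside ∷ S)  = ≤-trans (≤-reflexive (shift (weight S bs))) (bounds S)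
    -- The tail bound speaks of the set with the first element added. Submodularity removes that
    -- element again: its marginal value over `S` is at most `b`, its marginal value over the empty
    -- set.
    bounds′ (outside ∷ S) = +-cancelʳ-≤ (f (inside ∷ ⊥)) _ _ (begin
      weight S bs + f (outside ∷ ⊥) + f (inside ∷ ⊥)
        ≡⟨ rearrange (weight S bs) _ _ ⟩
      weight S bs + f (inside ∷ ⊥) + f (outside ∷ ⊥)
        ≤⟨ +-monoˡ-≤ _ (bounds S) ⟩
      f (inside ∷ S) + f (outside ∷ ⊥)
        ≡⟨ cong₂ (λ X Y → f (inside ∷ X) + f (outside ∷ Y))
             (Subsetₚ.∪-identityʳ S) (Subsetₚ.∩-zeroʳ S) ⟨
      f (inside ∷ (S ∪ ⊥)) + f (outside ∷ (S ∩ ⊥))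
        ≤⟨ submodular (outside ∷ S) (inside ∷ ⊥) ⟩
      f (outside ∷ S) + f (inside ∷ ⊥) ∎)
      where
      rearrange : ∀ x y z → x + y + z ≡ x + z + y
      rearrange = ℕSolver.solve-∀

    total′ : weight ⊤ (b ∷ bs) + f (outside ∷ ⊥) ≡ f (inside ∷ ⊤)
    total′ = trans (shift (weight ⊤ bs)) total

  module _ {n} (M : Matroid n) where

    open Matroid M

    r⊥≡0 : r ⊥ ≡ 0
    r⊥≡0 = n≤0⇒n≡0 (≤-trans (r-bounded ⊥) (≤-reflexive (Subsetₚ.∣⊥∣≡0 n)))

    -- The restriction to `A`, extended to all subsets so that the elements outside `A` become
    -- loops.
    ∩-polymatroid : ∀ A → IsPolymatroid (λ S → r (S ∩ A))
    ∩-polymatroid A = record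
      { monotone   = λ {S} {T} S⊆T → r-monotone λ x∈ →
          let x∈S , x∈A = Subsetₚ.x∈p∩q⁻ S A x∈ in Subsetₚ.x∈p∩q⁺ (S⊆T x∈S , x∈A)
      ; submodular = λ S T → subst₂ (λ X Y → r X + r Y ≤ r (S ∩ A) + r (T ∩ A))
          (sym (Subsetₚ.∩-distribʳ-∪ A S T)) (sym (∩-distribʳ-∩ S T))
          (r-submod (S ∩ A) (T ∩ A))
      }
      where
      ∩-distribʳ-∩ : ∀ S T → (S ∩ T) ∩ A ≡ (S ∩ A) ∩ (T ∩ A)
      ∩-distribʳ-∩ S T = trans (cong ((S ∩ T) ∩_) (sym (Subsetₚ.∩-idem A)))
        (∩-interchange S T A A)
        where
        open CommutativeSemigroupProperties
            (CommutativeMonoid.commutativeSemigroup (Subsetₚ.∩-commutativeMonoid n))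
          using () renaming (interchange to ∩-interchange)

    -- The contraction of `A`, up to the additive constant `r A`, with the elements of `A` kept as
    -- loops.
    ∪-polymatroid : ∀ A → IsPolymatroid (λ S → r (S ∪ A))
    ∪-polymatroid A = record
      { monotone   = λ {S} {T} S⊆T → r-monotone λ x∈ →
          Subsetₚ.x∈p∪q⁺ (map₁ S⊆T (Subsetₚ.x∈p∪q⁻ S A x∈))
      ; submodular = λ S T → subst₂ (λ X Y → r X + r Y ≤ r (S ∪ A) + r (T ∪ A))
          (sym (∪-distribʳ-∪ S T)) (sym (Subsetₚ.∪-distribʳ-∩ A S T))
          (r-submod (S ∪ A) (T ∪ A))
      }
      where
      ∪-distribʳ-∪ : ∀ S T → (S ∪ T) ∪ A ≡ (S ∪ A) ∪ (T ∪ A)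
      ∪-distribʳ-∪ S T = trans (cong ((S ∪ T) ∪_) (sym (Subsetₚ.∪-idem A)))
        (∪-interchange S T A A)
        where
        open CommutativeSemigroupProperties
            (CommutativeMonoid.commutativeSemigroup (Subsetₚ.∪-commutativeMonoid n))
          using () renaming (interchange to ∪-interchange)

    -- This is the greedy vertex for an order of the ground set that starts with A: x is
    -- its restriction to A and y its restriction to ∁ A.
    base-containing-basis-of : ∀ A → ∃[ b ]
      (∀ S → weight S b ≤ r S) × weight ⊤ b ≡ rank × weight A b ≡ r A
    base-containing-basis-of A
      with x , x-bound , x-total ← greedy (∩-polymatroid A)
         | y , y-bound , y-total ← greedy (∪-polymatroid A) =
      zipWith _+_ x y , bound , total , ≤-antisym (bound A) lower-bound
      where
      open ≤-Reasoning

      x-bound′ : ∀ S → weight S x ≤ r (S ∩ A)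
      x-bound′ S = ≤-trans (m≤m+n _ _) (x-bound S)

      y-bound′ : ∀ S → weight S y + r A ≤ r (S ∪ A)
      y-bound′ S = subst (λ X → weight S y + r X ≤ r (S ∪ A)) (Subsetₚ.∪-identityˡ A) (y-bound S)

      bound : ∀ S → weight S (zipWith _+_ x y) ≤ r S
      -- The bounds from restriction and contraction add up to `r (S ∩ A) + r (S ∪ A)`, which
      -- submodularity compares with `r S + r A`.
      bound S = +-cancelʳ-≤ (r A) _ _ (begin
        weight S (zipWith _+_ x y) + r A    ≡⟨ cong (_+ r A) (weight-+ S x y) ⟩
        weight S x + weight S y + r A       ≡⟨ +-assoc (weight S x) _ _ ⟩
        weight S x + (weight S y + r A)     ≤⟨ +-mono-≤ (x-bound′ S) (y-bound′ S) ⟩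
        r (S ∩ A) + r (S ∪ A)               ≡⟨ +-comm (r (S ∩ A)) _ ⟩
        r (S ∪ A) + r (S ∩ A)               ≤⟨ r-submod S A ⟩
        r S + r A                           ∎)

      total : weight ⊤ (zipWith _+_ x y) ≡ rank
      total = begin-equality
        weight ⊤ (zipWith _+_ x y)    ≡⟨ weight-+ ⊤ x y ⟩
        weight ⊤ x + weight ⊤ y       ≡⟨ cong (_+ weight ⊤ y) x-total′ ⟩
        r A + weight ⊤ y              ≡⟨ +-comm (r A) _ ⟩
        weight ⊤ y + r A              ≡⟨ cong (λ X → weight ⊤ y + r X) (Subsetₚ.∪-identityˡ A) ⟨
        weight ⊤ y + r (⊥ ∪ A)        ≡⟨ y-total ⟩
        r (⊤ ∪ A)                     ≡⟨ cong r (Subsetₚ.∪-zeroˡ A) ⟩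
        r ⊤                           ∎
        where
        x-total′ : weight ⊤ x ≡ r A
        x-total′ = begin-equality
          weight ⊤ x             ≡⟨ +-identityʳ _ ⟨
          weight ⊤ x + 0         ≡⟨ cong (weight ⊤ x +_) (trans (cong r (Subsetₚ.∩-zeroˡ A)) r⊥≡0) ⟨
          weight ⊤ x + r (⊥ ∩ A) ≡⟨ x-total ⟩
          r (⊤ ∩ A)              ≡⟨ cong r (Subsetₚ.∩-identityˡ A) ⟩
          r A                    ∎

      lower-bound : r A ≤ weight A (zipWith _+_ x y)
      -- `x` has no weight outside `A`, and `y` puts at most `rank - r A` there, so at least `r A`
      -- of the total weight `rank` lies on `A`.
      lower-bound = +-cancelʳ-≤ (weight (∁ A) y) _ _ (begin
        r A + weight (∁ A) y             ≡⟨ +-comm (r A) _ ⟩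
        weight (∁ A) y + r A             ≤⟨ y-bound′ (∁ A) ⟩
        r (∁ A ∪ A)                      ≤⟨ r-monotone Subsetₚ.⊆⊤ ⟩
        rank                             ≡⟨ total ⟨
        weight ⊤ (zipWith _+_ x y)       ≡⟨ weight-∁ A _ ⟨
        weight A (zipWith _+_ x y) + weight (∁ A) (zipWith _+_ x y)
          ≡⟨ cong (weight A (zipWith _+_ x y) +_) (weight-+ (∁ A) x y) ⟩
        weight A (zipWith _+_ x y) + (weight (∁ A) x + weight (∁ A) y)
          ≡⟨ cong (λ k → weight A (zipWith _+_ x y) + (k + weight (∁ A) y)) x-∁A≡0 ⟩
        weight A (zipWith _+_ x y) + weight (∁ A) y ∎)
        where
        x-∁A≡0 : weight (∁ A) x ≡ 0
        x-∁A≡0 = n≤0⇒n≡0 (≤-trans (x-bound′ (∁ A))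
          (≤-reflexive (trans (cong r (Subsetₚ.∩-inverseˡ A)) r⊥≡0)))

  sum-weight : ∀ {n} S (b : Vec ℕ n) →
    sumℤ (λ i → if lookup S i then lookup (map ℤ.+_ b) i else ℤ.+ 0) ≡ ℤ.+ weight S b
  sum-weight []            []       = refl
  sum-weight (outside ∷ S) (b ∷ bs) = trans (ℤₚ.+-identityˡ _) (sum-weight S bs)
  sum-weight (inside ∷ S)  (b ∷ bs) = cong (ℤ._+_ (ℤ.+ b)) (sum-weight S bs)

  sum-weight-⊤ : ∀ {n} (b : Vec ℕ n) → sumℤ (lookup (map ℤ.+_ b)) ≡ ℤ.+ weight ⊤ b
  sum-weight-⊤ []       = refl
  sum-weight-⊤ (b ∷ bs) = cong (ℤ._+_ (ℤ.+ b)) (sum-weight-⊤ bs)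

  isBase : ∀ {n} (M : Matroid n) {b} →
    (∀ S → weight S b ≤ Matroid.r M S) → weight ⊤ b ≡ Matroid.rank M → IsBase M (map ℤ.+_ b)
  isBase M {b} bound total =
    trans (sum-weight-⊤ b) (cong ℤ.+_ total) ,
    λ S → subst (ℤ._≤ _) (sym (sum-weight S b)) (ℤ.+≤+ (bound S))

open Bases

-- Lattice points of the Minkowski sum: linear inequalities and explicit decompositions

module LatticePoints where

  open ≡ hiding ([_])
  open import Data.Nat.Base using (_+_; _≤_)
  open ℕₚ
  open import Data.Vec.Base using (sum)
  open SemiringSum (CommutativeRing.semiring ℤₚ.+-*-commutativeRing) using ()
    renaming (sum to sumℤ; sum-cong-≗ to sumℤ-cong; *-distribˡ-sum to *-distribˡ-sumℤ)
  open SemiringSum (CommutativeRing.semiring ℚₚ.+-*-commutativeRing) using ()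
    renaming (sum to sumℚ; sum-cong-≗ to sumℚ-cong; ∑-comm to sumℚ-comm; ∑-distrib-+ to sumℚ-+;
              *-distribˡ-sum to *-distribˡ-sumℚ; *-distribʳ-sum to *-distribʳ-sumℚ)
  open ℚₚ using () renaming (*-assoc to ℚ*-assoc; *-comm to ℚ*-comm)

  fromℤ-sum : ∀ {n} (f : Fin n → ℤ) → fromℤ (sumℤ f) ≡ sumℚ (fromℤ ∘ f)
  fromℤ-sum {zero}  f = refl
  fromℤ-sum {suc n} f = trans (fromℤ-+ (f Fin.zero) _)
    (cong (ℚ._+_ (fromℤ (f Fin.zero))) (fromℤ-sum (f ∘ Fin.suc)))

  sumℚ-mono-≤ : ∀ {n} {f g : Fin n → ℚ} → (∀ i → f i ℚ.≤ g i) → sumℚ f ℚ.≤ sumℚ g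
  sumℚ-mono-≤ {zero}  f≤g = ℚₚ.≤-refl
  sumℚ-mono-≤ {suc n} f≤g = ℚₚ.+-mono-≤ (f≤g Fin.zero) (sumℚ-mono-≤ (f≤g ∘ Fin.suc))

  ⟨_,_⟩ : ∀ {n} → (Fin n → ℚ) → Vec ℚ n → ℚ
  ⟨ s , p ⟩ = sumℚ (λ j → s j ℚ.* lookup p j)

  -- An upper bound on the support function of `A` in the direction `s`. Support functions add under
  -- `⊕` and are unchanged by `conv`, so bounds at the vertices pass to the whole region.
  record _≤[_]_ {n} (A : Region n) (s : Fin n → ℚ) (k : ℚ) : Set where
    constructor bounded
    field bound : ∀ {p} → A p → ⟨ s , p ⟩ ℚ.≤ k
  open _≤[_]_

  ⊕-bound : ∀ {n} {A B : Region n} {s k l} → A ≤[ s ] k → B ≤[ s ] l → (A ⊕ B) ≤[ s ] (k ℚ.+ l)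
  ⊕-bound {s = s} {k} {l} (bounded f) (bounded g) .bound (a , b , Aa , Bb , refl) = begin
    ⟨ s , zipWith ℚ._+_ a b ⟩
      ≡⟨ sumℚ-cong (λ j → trans (cong (ℚ._*_ (s j)) (lookup-zipWith ℚ._+_ j a b))
                                 (ℚₚ.*-distribˡ-+ (s j) (lookup a j) (lookup b j))) ⟩
    sumℚ (λ j → s j ℚ.* lookup a j ℚ.+ s j ℚ.* lookup b j)
      ≡⟨ sumℚ-+ (λ j → s j ℚ.* lookup a j) _ ⟩
    ⟨ s , a ⟩ ℚ.+ ⟨ s , b ⟩
      ≤⟨ ℚₚ.+-mono-≤ (f Aa) (g Bb) ⟩
    k ℚ.+ l ∎
    where open ℚₚ.≤-Reasoning

  -- The factor moves into the functional, not into the bound, so negative factors, as in `∇`, call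
  -- for no separate case.
  •-bound : ∀ {n} {A : Region n} {s k} c → A ≤[ (λ j → c ℚ.* s j) ] k → (c • A) ≤[ s ] k
  •-bound {s = s} {k} c (bounded f) .bound (a , Aa , refl) = begin
    ⟨ s , map (c ℚ.*_) a ⟩
      ≡⟨ sumℚ-cong (λ j → trans (cong (ℚ._*_ (s j)) (lookup-map j (c ℚ.*_) a))
           (trans (sym (ℚ*-assoc (s j) c (lookup a j)))
             (cong (ℚ._* lookup a j) (ℚ*-comm (s j) c)))) ⟩
    ⟨ (λ j → c ℚ.* s j) , a ⟩
      ≤⟨ f Aa ⟩
    k ∎
    where open ℚₚ.≤-Reasoning

  conv-bound : ∀ {n} {A : Region n} {s k} → A ≤[ s ] k → conv A ≤[ s ] k
  conv-bound {s = s} {k} (bounded f) .bound (m , w , v , w≥0 , Σw≡1 , Av , refl) = begin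
    ⟨ s , tabulate (λ j → sumℚ (λ i → w i ℚ.* lookup (v i) j)) ⟩
      ≡⟨ sumℚ-cong (λ j → trans (cong (ℚ._*_ (s j)) (lookup∘tabulate _ j))
           (trans (*-distribˡ-sumℚ (s j) (λ i → w i ℚ.* lookup (v i) j))
             (sumℚ-cong (λ i → swap (s j) (w i) (lookup (v i) j))))) ⟩
    sumℚ (λ j → sumℚ (λ i → w i ℚ.* (s j ℚ.* lookup (v i) j)))
      ≡⟨ sumℚ-comm (λ j i → w i ℚ.* (s j ℚ.* lookup (v i) j)) ⟩
    sumℚ (λ i → sumℚ (λ j → w i ℚ.* (s j ℚ.* lookup (v i) j)))
      ≡⟨ sumℚ-cong (λ i → *-distribˡ-sumℚ (w i) (λ j → s j ℚ.* lookup (v i) j)) ⟨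
    sumℚ (λ i → w i ℚ.* ⟨ s , v i ⟩)
      ≤⟨ sumℚ-mono-≤ (λ i → ℚₚ.*-monoˡ-≤-nonNeg (w i) {{ℚ.nonNegative (w≥0 i)}} (f (Av i))) ⟩
    sumℚ (λ i → w i ℚ.* k)
      ≡⟨ *-distribʳ-sumℚ k w ⟨
    sumℚ w ℚ.* k
      ≡⟨ trans (cong (ℚ._* k) Σw≡1) (ℚₚ.*-identityˡ k) ⟩
    k ∎
    where
    open ℚₚ.≤-Reasoning
    swap : ∀ a b c → a ℚ.* (b ℚ.* c) ≡ b ℚ.* (a ℚ.* c)
    swap a b c = trans (sym (ℚ*-assoc a b c)) (trans (cong (ℚ._* c) (ℚ*-comm a b)) (ℚ*-assoc b a c))

  sumℚ-0 : ∀ {n} {f : Fin n → ℚ} → (∀ i → f i ≡ 0ℚ) → sumℚ f ≡ 0ℚ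
  sumℚ-0 {zero}  f≡0 = refl
  sumℚ-0 {suc n} f≡0 = cong₂ ℚ._+_ (f≡0 Fin.zero) (sumℚ-0 (f≡0 ∘ Fin.suc))

  unit : ∀ {n} → Fin n → Vec ℚ n
  unit {n} i = replicate n 0ℚ [ i ]≔ 1ℚ

  ⟨,unit⟩ : ∀ {n} (s : Fin n → ℚ) i → ⟨ s , unit i ⟩ ≡ s i
  ⟨,unit⟩ s Fin.zero = trans
    (cong₂ ℚ._+_ (ℚₚ.*-identityʳ (s Fin.zero)) (sumℚ-0 λ j →
      trans (cong (ℚ._*_ (s (Fin.suc j))) (lookup-replicate j 0ℚ)) (ℚₚ.*-zeroʳ (s (Fin.suc j)))))
    (ℚₚ.+-identityʳ _)
  ⟨,unit⟩ s (Fin.suc i) = trans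
    (cong₂ ℚ._+_ (ℚₚ.*-zeroʳ (s Fin.zero)) (⟨,unit⟩ (s ∘ Fin.suc) i)) (ℚₚ.+-identityˡ _)

  sum-unit : ∀ {n} (w : Fin n → ℚ) j → sumℚ (λ i → w i ℚ.* lookup (unit i) j) ≡ w j
  sum-unit w j = trans (sumℚ-cong (λ i → cong (ℚ._*_ (w i)) (unit-sym i j))) (⟨,unit⟩ w j)
    where
    unit-sym : ∀ {n} (i j : Fin n) → lookup (unit i) j ≡ lookup (unit j) i
    unit-sym Fin.zero    Fin.zero    = refl
    unit-sym Fin.zero    (Fin.suc j) = lookup-replicate j 0ℚ
    unit-sym (Fin.suc i) Fin.zero    = sym (lookup-replicate i 0ℚ)
    unit-sym (Fin.suc i) (Fin.suc j) = unit-sym i j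

  Δ-bound : ∀ {n s k} → (∀ i → s i ℚ.≤ k) → Δ n ≤[ s ] k
  Δ-bound {n} {s} {k} s≤k = conv-bound {A = λ p → ∃[ i ] p ≡ unit {n} i} (bounded λ { (i , refl) →
    subst (ℚ._≤ k) (sym (⟨,unit⟩ s i)) (s≤k i) })

  fromℤ-⟨⟩ : ∀ {n} (s : Fin n → ℤ) (x : Vec ℤ n) →
    ⟨ fromℤ ∘ s , map fromℤ x ⟩ ≡ fromℤ (sumℤ (λ j → s j ℤ.* lookup x j))
  fromℤ-⟨⟩ s x = trans
    (sumℚ-cong (λ j → trans (cong (ℚ._*_ (fromℤ (s j))) (lookup-map j fromℤ x))
                            (sym (fromℤ-* (s j) (lookup x j)))))
    (sym (fromℤ-sum (λ j → s j ℤ.* lookup x j)))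

  module _ {n} (M : Matroid n) where

    open Matroid M

    Q-region : ℕ → ℕ → Region n
    Q-region t u = P M ⊕ fromℕ u • Δ n ⊕ fromℕ t • ∇ n

    -- Each summand is bounded separately at its vertices. These are integral and so is the
    -- functional, so the rational estimate descends to the integers.
    latticePoint-bound : ∀ {t u} z → Q-region t u (map fromℤ z) →
      ∀ (s : Fin n → ℤ) {k l m} →
      (∀ x → IsBase M x → sumℤ (λ j → s j ℤ.* lookup x j) ℤ.≤ k) →
      (∀ i → ℤ.+ u ℤ.* s i ℤ.≤ l) →
      (∀ i → ℤ.-1ℤ ℤ.* (ℤ.+ t ℤ.* s i) ℤ.≤ m) →
      sumℤ (λ j → s j ℤ.* lookup z j) ℤ.≤ k ℤ.+ l ℤ.+ m
    latticePoint-bound {t} {u} z z∈Q s {k} {l} {m} P≤k Δ≤l ∇≤m = fromℤ-cancel-≤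
      (subst₂ ℚ._≤_ (fromℤ-⟨⟩ s z)
        (sym (trans (fromℤ-+ (k ℤ.+ l) m) (cong (ℚ._+ fromℤ m) (fromℤ-+ k l))))
        (bound (⊕-bound (⊕-bound P-bound (•-bound (fromℕ u) (Δ-bound Δ≤l′)))
                        (•-bound (fromℕ t) (•-bound (ℚ.- 1ℚ) (Δ-bound ∇≤m′)))) z∈Q))
      where
      P-bound : P M ≤[ fromℤ ∘ s ] fromℤ k
      P-bound = conv-bound {A = λ p → ∃[ x ] IsBase M x × p ≡ map fromℤ x} (bounded λ { (x , base , refl) →
        subst (ℚ._≤ fromℤ k) (sym (fromℤ-⟨⟩ s x)) (fromℤ-mono-≤ (P≤k x base)) })
      Δ≤l′ : ∀ i → fromℕ u ℚ.* fromℤ (s i) ℚ.≤ fromℤ l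
      Δ≤l′ i = subst (ℚ._≤ fromℤ l) (fromℤ-* (ℤ.+ u) (s i)) (fromℤ-mono-≤ (Δ≤l i))
      ∇≤m′ : ∀ i → ℚ.- 1ℚ ℚ.* (fromℕ t ℚ.* fromℤ (s i)) ℚ.≤ fromℤ m
      ∇≤m′ i = subst (ℚ._≤ fromℤ m)
        (trans (fromℤ-* ℤ.-1ℤ (ℤ.+ t ℤ.* s i)) (cong (ℚ._*_ (ℚ.- 1ℚ)) (fromℤ-* (ℤ.+ t) (s i))))
        (fromℤ-mono-≤ (∇≤m i))

  indicator : ∀ {n} → Subset n → Fin n → ℤ
  indicator S i = if lookup S i then ℤ.1ℤ else ℤ.0ℤ

  sum-indicator : ∀ {n} S (x : Vec ℤ n) →
    sumℤ (λ i → indicator S i ℤ.* lookup x i) ≡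
    sumℤ (λ i → if lookup S i then lookup x i else ℤ.0ℤ)
  sum-indicator S x = sumℤ-cong λ i → lemma (lookup S i)
    where
    lemma : ∀ b {y} → (if b then ℤ.1ℤ else ℤ.0ℤ) ℤ.* y ≡ (if b then y else ℤ.0ℤ)
    lemma true  = ℤₚ.*-identityˡ _
    lemma false = refl

  sum-posSupp : ∀ {n} (z : Vec ℤ n) →
    sumℤ (λ i → if lookup (posSupp z) i then lookup z i else ℤ.0ℤ) ≡ ℤ.+ pos z
  sum-posSupp []                = refl
  sum-posSupp ((ℤ.+ zero) ∷ zs) = trans (ℤₚ.+-identityˡ _) (sum-posSupp zs)
  sum-posSupp (+[1+ k ] ∷ zs)   = cong (ℤ._+_ +[1+ k ]) (sum-posSupp zs)
  sum-posSupp (-[1+ k ] ∷ zs)   = trans (ℤₚ.+-identityˡ _) (sum-posSupp zs)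

  posPart-negPart : ∀ z → z ℤ.+ ℤ.+ negPart z ≡ ℤ.+ posPart z
  posPart-negPart (ℤ.+ k)  = ℤₚ.+-identityʳ _
  posPart-negPart -[1+ k ] = ℤₚ.+-inverseˡ +[1+ k ]

  sum-pos-neg : ∀ {n} (z : Vec ℤ n) → sumℤ (lookup z) ℤ.+ ℤ.+ neg z ≡ ℤ.+ pos z
  sum-pos-neg []       = refl
  sum-pos-neg (z ∷ zs) = begin
    z ℤ.+ sumℤ (lookup zs) ℤ.+ (ℤ.+ negPart z ℤ.+ ℤ.+ neg zs)
      ≡⟨ interchange z _ _ _ ⟩
    (z ℤ.+ ℤ.+ negPart z) ℤ.+ (sumℤ (lookup zs) ℤ.+ ℤ.+ neg zs)
      ≡⟨ cong₂ ℤ._+_ (posPart-negPart z) (sum-pos-neg zs) ⟩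
    ℤ.+ posPart z ℤ.+ ℤ.+ pos zs ∎
    where
    open ≡-Reasoning
    open CommutativeSemigroupProperties ℤₚ.+-commutativeSemigroup using (interchange)

  module _ {n} (M : Matroid n) where

    open Matroid M

    -- Three functionals suffice. The indicator of the positive support is at most `ρ` on bases, `u`
    -- on the dilate of Δ and 0 on that of ∇; the slack of this inequality is `k`. The all-ones
    -- vector and its negative fix the coordinate sum as `rank + u - t`, which forces the same `k`
    -- for t.
    latticePoint⇒Diagonal : ∀ {t u} z → Q-region M t u (map fromℤ z) → Diagonal M t u z
    latticePoint⇒Diagonal {t} {u} z z∈Q = k , t≡ , u≡
      where
      ρ = r (posSupp z)

      pos≤ : pos z ≤ r (posSupp z) + u
      pos≤ = ℤₚ.drop‿+≤+ (subst₂ ℤ._≤_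
        (trans (sum-indicator (posSupp z) z) (sum-posSupp z)) (ℤₚ.+-identityʳ _)
        (latticePoint-bound M {t} {u} z z∈Q (indicator (posSupp z))
          (λ x (_ , x-bound) →
            subst (ℤ._≤ _) (sym (sum-indicator (posSupp z) x)) (x-bound (posSupp z)))
          (λ i → Δ≤ (lookup (posSupp z) i))
          (λ i → ∇≤ (lookup (posSupp z) i))))
        where
        Δ≤ : ∀ b → ℤ.+ u ℤ.* (if b then ℤ.1ℤ else ℤ.0ℤ) ℤ.≤ ℤ.+ u
        Δ≤ true  = ℤₚ.≤-reflexive (ℤₚ.*-identityʳ (ℤ.+ u))
        Δ≤ false = subst (ℤ._≤ ℤ.+ u) (sym (ℤₚ.*-zeroʳ (ℤ.+ u))) (ℤ.+≤+ z≤n)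
        ∇≤ : ∀ b → ℤ.-1ℤ ℤ.* (ℤ.+ t ℤ.* (if b then ℤ.1ℤ else ℤ.0ℤ)) ℤ.≤ ℤ.0ℤ
        ∇≤ true  = subst (ℤ._≤ ℤ.0ℤ) (sym (trans (cong (ℤ._*_ ℤ.-1ℤ) (ℤₚ.*-identityʳ (ℤ.+ t)))
          (ℤₚ.-1*i≡-i (ℤ.+ t)))) ℤₚ.neg-≤-pos
        ∇≤ false = ℤₚ.≤-reflexive (cong (ℤ._*_ ℤ.-1ℤ) (ℤₚ.*-zeroʳ (ℤ.+ t)))

      slack : ∃[ k ] pos z + k ≡ ρ + u
      slack = m≤n⇒∃[o]m+o≡n pos≤

      k = proj₁ slack
      pos+k = proj₂ slack

      total : sumℤ (lookup z) ≡ ℤ.+ rank ℤ.+ ℤ.+ u ℤ.+ ℤ.- (ℤ.+ t)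
      total = ℤₚ.≤-antisym
        (subst (ℤ._≤ _) (sumℤ-cong (λ i → ℤₚ.*-identityˡ (lookup z i)))
          (latticePoint-bound M {t} {u} z z∈Q (λ _ → ℤ.1ℤ)
            (λ x (x-total , _) → ℤₚ.≤-reflexive
              (trans (sumℤ-cong (λ i → ℤₚ.*-identityˡ (lookup x i))) x-total))
            (λ _ → ℤₚ.≤-reflexive (ℤₚ.*-identityʳ (ℤ.+ u)))
            (λ _ → ℤₚ.≤-reflexive (trans (cong (ℤ._*_ ℤ.-1ℤ) (ℤₚ.*-identityʳ (ℤ.+ t)))
              (ℤₚ.-1*i≡-i (ℤ.+ t))))))
        (ℤₚ.neg-cancel-≤ (subst₂ ℤ._≤_
          (trans (sym (*-distribˡ-sumℤ ℤ.-1ℤ (lookup z))) (ℤₚ.-1*i≡-i _))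
          (neg-total (ℤ.+ rank) (ℤ.+ u) (ℤ.+ t))
          (latticePoint-bound M {t} {u} z z∈Q (λ _ → ℤ.-1ℤ)
            (λ x (x-total , _) → ℤₚ.≤-reflexive
              (trans (sym (*-distribˡ-sumℤ ℤ.-1ℤ (lookup x)))
                (trans (ℤₚ.-1*i≡-i _) (cong ℤ.-_ x-total))))
            (λ _ → ℤₚ.≤-reflexive (trans (ℤₚ.*-comm (ℤ.+ u) ℤ.-1ℤ) (ℤₚ.-1*i≡-i (ℤ.+ u))))
            (λ _ → ℤₚ.≤-reflexive (trans (cong (ℤ._*_ ℤ.-1ℤ)
              (trans (ℤₚ.*-comm (ℤ.+ t) ℤ.-1ℤ) (ℤₚ.-1*i≡-i (ℤ.+ t))))
              (trans (ℤₚ.-1*i≡-i (ℤ.- (ℤ.+ t))) (ℤₚ.neg-involutive (ℤ.+ t))))))))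
        where
        neg-total : ∀ a b c → ℤ.- a ℤ.+ ℤ.- b ℤ.+ c ≡ ℤ.- (a ℤ.+ b ℤ.+ ℤ.- c)
        neg-total = ℤSolver.solve-∀

      pos+t : pos z + t ≡ neg z + (rank + u)
      pos+t = ℤₚ.+-injective (begin
        ℤ.+ pos z ℤ.+ ℤ.+ t
          ≡⟨ cong (ℤ._+ ℤ.+ t) (sum-pos-neg z) ⟨
        sumℤ (lookup z) ℤ.+ ℤ.+ neg z ℤ.+ ℤ.+ t
          ≡⟨ cong (λ s → s ℤ.+ ℤ.+ neg z ℤ.+ ℤ.+ t) total ⟩
        ℤ.+ rank ℤ.+ ℤ.+ u ℤ.+ ℤ.- (ℤ.+ t) ℤ.+ ℤ.+ neg z ℤ.+ ℤ.+ t
          ≡⟨ cancel (ℤ.+ rank) (ℤ.+ u) (ℤ.+ t) (ℤ.+ neg z) ⟩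
        ℤ.+ neg z ℤ.+ (ℤ.+ rank ℤ.+ ℤ.+ u) ∎)
        where
        open ≡-Reasoning
        cancel : ∀ a b c d → a ℤ.+ b ℤ.+ ℤ.- c ℤ.+ d ℤ.+ c ≡ d ℤ.+ (a ℤ.+ b)
        cancel = ℤSolver.solve-∀

      u≡ : u ≡ excess M z + k
      u≡ = +-cancelˡ-≡ ρ _ _ (begin
        ρ + u                    ≡⟨ pos+k ⟨
        pos z + k                ≡⟨ cong (ℕ._+ k) (r+excess M z) ⟨
        ρ + excess M z + k       ≡⟨ +-assoc ρ _ _ ⟩
        ρ + (excess M z + k)     ∎)
        where open ≡-Reasoning

      t≡ : t ≡ deficiency M z + k
      t≡ = +-cancelˡ-≡ (pos z) _ _ (begin
        pos z + t                          ≡⟨ pos+t ⟩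
        neg z + (rank + u)                 ≡⟨ cong (λ ρ → neg z + (ρ + u)) (r+corank M (posSupp z)) ⟨
        neg z + (ρ + corank M (posSupp z) + u) ≡⟨ rearrange (neg z) ρ _ u ⟩
        ρ + u + deficiency M z             ≡⟨ cong (ℕ._+ deficiency M z) pos+k ⟨
        pos z + k + deficiency M z         ≡⟨ rearrange′ (pos z) k _ ⟩
        pos z + (deficiency M z + k)       ∎)
        where
        open ≡-Reasoning
        rearrange : ∀ a b c d → a + (b + c + d) ≡ b + d + (a + c)
        rearrange = ℕSolver.solve-∀
        rearrange′ : ∀ a b c → a + b + c ≡ a + (c + b)
        rearrange′ = ℕSolver.solve-∀

  conv-⊇ : ∀ {n} {A : Region n} {p} → A p → conv A p
  conv-⊇ {p = p} Ap = 1 , (λ _ → 1ℚ) , (λ _ → p) , (λ _ → ℚₚ.nonNegative⁻¹ 1ℚ) , refl , (λ _ → Ap) ,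
    trans (sym (tabulate∘lookup p)) (tabulate-cong λ j →
      sym (trans (ℚₚ.+-identityʳ _) (ℚₚ.*-identityˡ (lookup p j))))

  fromℕ-sum : ∀ {n} (α : Vec ℕ n) → sumℚ (λ j → fromℕ (lookup α j)) ≡ fromℕ (sum α)
  fromℕ-sum []      = refl
  fromℕ-sum (k ∷ α) = trans (cong (ℚ._+_ (fromℕ k)) (fromℕ-sum α)) (sym (fromℕ-+ k (sum α)))

  sum≡0⇒≡0 : ∀ {n} (α : Vec ℕ n) → sum α ≡ 0 → ∀ j → lookup α j ≡ 0
  sum≡0⇒≡0 (k ∷ α) eq Fin.zero    = m+n≡0⇒m≡0 k eq
  sum≡0⇒≡0 (k ∷ α) eq (Fin.suc j) = sum≡0⇒≡0 α (m+n≡0⇒n≡0 k eq) j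

  -- For positive u the barycentric coordinates are the entries of `α` divided by u. For u = 0 the
  -- vector `α` vanishes and any point of Δ serves; there is one because the ground set is nonempty.
  dilatedSimplex : ∀ {n} u (α : Vec ℕ (suc n)) → sum α ≡ u →
    (fromℕ u • Δ (suc n)) (map fromℕ α)
  dilatedSimplex zero α Σα≡0 =
    unit Fin.zero , conv-⊇ {A = λ p → ∃[ i ] p ≡ unit i} (Fin.zero , refl) ,
    trans (sym (tabulate∘lookup _)) (trans (tabulate-cong λ j → begin
      lookup (map fromℕ α) j                  ≡⟨ lookup-map j fromℕ α ⟩
      fromℕ (lookup α j)                      ≡⟨ cong fromℕ (sum≡0⇒≡0 α Σα≡0 j) ⟩
      0ℚ                                      ≡⟨ ℚₚ.*-zeroˡ (lookup e j) ⟨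
      0ℚ ℚ.* lookup e j                       ≡⟨ lookup-map j (ℚ._*_ 0ℚ) e ⟨
      lookup (map (ℚ._*_ 0ℚ) e) j             ∎)
    (tabulate∘lookup _))
    where
    open ≡-Reasoning
    e = unit Fin.zero
  dilatedSimplex (suc u) α Σα≡u =
    tabulate coeff ,
    (_ , coeff , unit , coeff≥0 , Σw≡1 , (λ i → i , refl) ,
     sym (tabulate-cong (sum-unit coeff))) ,
    trans (sym (tabulate∘lookup _)) (trans (tabulate-cong λ j → begin
      lookup (map fromℕ α) j                             ≡⟨ lookup-map j fromℕ α ⟩
      fromℕ (lookup α j)                                 ≡⟨ ℚₚ.*-identityʳ _ ⟨
      fromℕ (lookup α j) ℚ.* 1ℚ
        ≡⟨ cong (ℚ._*_ (fromℕ (lookup α j))) (ℚₚ.*-inverseˡ U) ⟨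
      fromℕ (lookup α j) ℚ.* (1/U ℚ.* U)                 ≡⟨ ℚₚ.*-assoc (fromℕ (lookup α j)) 1/U U ⟨
      coeff j ℚ.* U                                          ≡⟨ ℚₚ.*-comm (coeff j) U ⟩
      U ℚ.* coeff j                                          ≡⟨ cong (ℚ._*_ U) (lookup∘tabulate coeff j) ⟨
      U ℚ.* lookup (tabulate coeff) j                        ≡⟨ lookup-map j (ℚ._*_ U) (tabulate coeff) ⟨
      lookup (map (ℚ._*_ U) (tabulate coeff)) j              ∎)
    (tabulate∘lookup _))
    where
    open ≡-Reasoning
    U 1/U : ℚ
    U   = fromℕ (suc u)
    instance
      U-pos : ℚ.Positive U
      U-pos = ℚₚ.normalize-pos (suc u) 1
      U≢0 : ℚ.NonZero U
      U≢0 = ℚₚ.pos⇒nonZero U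
    1/U = ℚ.1/ U
    coeff : Fin _ → ℚ
    coeff j = fromℕ (lookup α j) ℚ.* 1/U
    coeff≥0 : ∀ j → 0ℚ ℚ.≤ coeff j
    coeff≥0 j = subst (ℚ._≤ coeff j) (ℚₚ.*-zeroˡ 1/U)
      (ℚₚ.*-monoʳ-≤-nonNeg 1/U {{ℚₚ.pos⇒nonNeg 1/U {{ℚₚ.1/pos⇒pos U}}}}
        (fromℤ-mono-≤ {ℤ.0ℤ} {ℤ.+ lookup α j} (ℤ.+≤+ z≤n)))
    Σw≡1 : sumℚ coeff ≡ 1ℚ
    Σw≡1 = trans (sym (*-distribʳ-sumℚ 1/U (λ j → fromℕ (lookup α j))))
      (trans (cong (ℚ._* 1/U) (trans (fromℕ-sum α) (cong fromℕ Σα≡u))) (ℚₚ.*-inverseʳ U))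

  -- A coordinate of z - b = α - β with k added to both α and β.  The weights in α≡ and
  -- β≡ are b if z is positive and 0 otherwise.
  record Split (z : ℤ) (b k : ℕ) : Set where
    constructor split
    field
      {α β} : ℕ
      z≡    : z ≡ ℤ.+ b ℤ.+ ℤ.+ α ℤ.+ ℤ.-1ℤ ℤ.* ℤ.+ β
      α≡    : α + weight (isPositive z ∷ []) (b ∷ []) ≡ posPart z + k
      β≡    : β + weight (isPositive z ∷ []) (b ∷ []) ≡ negPart z + b + k

  -- Since `b ≤ 1`, a positive z satisfies z ≥ b, and any other z satisfies z ≤ b. So z - b never
  -- has the sign opposite to that of z, and its positive and negative parts are as small as the
  -- sums require. A larger `b` would fail at z = 1.
  splitCoordinate : ∀ z {b} → b ≤ 1 → ∀ k → Split z b k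
  splitCoordinate (ℤ.+ zero) {b} _ k = split {α = k} {b + k}
    (lemma (ℤ.+ b) (ℤ.+ k)) (+-identityʳ k) (+-identityʳ (b + k))
    where
    lemma : ∀ x y → ℤ.0ℤ ≡ x ℤ.+ y ℤ.+ ℤ.-1ℤ ℤ.* (x ℤ.+ y)
    lemma = ℤSolver.solve-∀
  splitCoordinate +[1+ a ] {zero} _ k = split {α = suc a + k} {k}
    (lemma +[1+ a ] (ℤ.+ k)) (+-identityʳ _) (+-identityʳ k)
    where
    lemma : ∀ x y → x ≡ ℤ.0ℤ ℤ.+ (x ℤ.+ y) ℤ.+ ℤ.-1ℤ ℤ.* y
    lemma = ℤSolver.solve-∀
  splitCoordinate +[1+ a ] {suc zero} _ k = split {α = a + k} {k}
    (lemma (ℤ.+ a) (ℤ.+ k)) (+-comm (a + k) 1) (+-comm k 1)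
    where
    lemma : ∀ x y → ℤ.1ℤ ℤ.+ x ≡ ℤ.1ℤ ℤ.+ (x ℤ.+ y) ℤ.+ ℤ.-1ℤ ℤ.* y
    lemma = ℤSolver.solve-∀
  splitCoordinate +[1+ a ] {suc (suc b)} (s≤s ()) k
  splitCoordinate -[1+ a ] {b} _ k = split {α = k} {suc a + b + k}
    (lemma +[1+ a ] (ℤ.+ b) (ℤ.+ k)) (+-identityʳ k) (+-identityʳ _)
    where
    lemma : ∀ x y z → ℤ.- x ≡ y ℤ.+ z ℤ.+ ℤ.-1ℤ ℤ.* (x ℤ.+ y ℤ.+ z)
    lemma = ℤSolver.solve-∀

  combine : ∀ {n} → Vec ℕ n → Vec ℕ n → Vec ℕ n → Vec ℚ n
  combine b α β = zipWith ℚ._+_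
    (zipWith ℚ._+_ (map fromℤ (map ℤ.+_ b)) (map fromℕ α))
    (map (ℚ.- 1ℚ ℚ.*_) (map fromℕ β))

  record Decomposition {n} (z : Vec ℤ n) (b : Vec ℕ n) (k : ℕ) : Set where
    constructor decomposition
    field
      {α β} : Vec ℕ n
      z≡    : map fromℤ z ≡ combine b α β
      Σα    : sum α + weight (posSupp z) b ≡ pos z + k
      Σβ    : sum β + weight (posSupp z) b ≡ neg z + weight ⊤ b + k

  weight-∷ : ∀ {n} s (S : Subset n) b bs →
    weight (s ∷ S) (b ∷ bs) ≡ weight (s ∷ []) (b ∷ []) + weight S bs
  weight-∷ outside S b bs = refl
  weight-∷ inside  S b bs = cong (ℕ._+ weight S bs) (sym (+-identityʳ b))

  decompose-∷ : ∀ {n z b} {zs : Vec ℤ n} {bs} {k l} → Split z b k → Decomposition zs bs l →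
    Decomposition (z ∷ zs) (b ∷ bs) (k + l)
  decompose-∷ {z = z} {b} {zs} {bs} {k} {l}
      (split {α₀} {β₀} z≡ α≡ β≡) (decomposition {α} {β} zs≡ Σα Σβ) =
    decomposition {α = α₀ ∷ α} {β₀ ∷ β} (cong₂ _∷_ z≡′ zs≡)
      (begin
        α₀ + sum α + weight (posSupp (z ∷ zs)) (b ∷ bs)
          ≡⟨ cong (ℕ._+_ (α₀ + sum α)) (weight-∷ (isPositive z) (posSupp zs) b bs) ⟩
        α₀ + sum α + (weight (isPositive z ∷ []) (b ∷ []) + weight (posSupp zs) bs)
          ≡⟨ interchange α₀ (sum α) _ _ ⟩
        (α₀ + weight (isPositive z ∷ []) (b ∷ [])) + (sum α + weight (posSupp zs) bs)
          ≡⟨ cong₂ ℕ._+_ α≡ Σα ⟩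
        (posPart z + k) + (pos zs + l)
          ≡⟨ interchange (posPart z) k _ _ ⟩
        (posPart z + pos zs) + (k + l) ∎)
      (begin
        β₀ + sum β + weight (posSupp (z ∷ zs)) (b ∷ bs)
          ≡⟨ cong (ℕ._+_ (β₀ + sum β)) (weight-∷ (isPositive z) (posSupp zs) b bs) ⟩
        β₀ + sum β + (weight (isPositive z ∷ []) (b ∷ []) + weight (posSupp zs) bs)
          ≡⟨ interchange β₀ (sum β) _ _ ⟩
        (β₀ + weight (isPositive z ∷ []) (b ∷ [])) + (sum β + weight (posSupp zs) bs)
          ≡⟨ cong₂ ℕ._+_ β≡ Σβ ⟩
        (negPart z + b + k) + (neg zs + weight ⊤ bs + l)
          ≡⟨ rearrange (negPart z) b k (neg zs) (weight ⊤ bs) l ⟩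
        (negPart z + neg zs) + (b + weight ⊤ bs) + (k + l) ∎)
    where
    open ≡-Reasoning
    open CommutativeSemigroupProperties +-commutativeSemigroup using (interchange)
    rearrange : ∀ a b c d e f → (a + b + c) + (d + e + f) ≡ (a + d) + (b + e) + (c + f)
    rearrange = ℕSolver.solve-∀
    z≡′ : fromℤ z ≡ fromℕ b ℚ.+ fromℕ α₀ ℚ.+ ℚ.- 1ℚ ℚ.* fromℕ β₀
    z≡′ = trans (cong fromℤ z≡) (trans (fromℤ-+ (ℤ.+ b ℤ.+ ℤ.+ α₀) (ℤ.-1ℤ ℤ.* ℤ.+ β₀))
      (cong₂ ℚ._+_ (fromℕ-+ b α₀) (fromℤ-* ℤ.-1ℤ (ℤ.+ β₀))))

  -- The first coordinate absorbs all of k.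
  decompose₀ : ∀ {n} (z : Vec ℤ n) {b} → (∀ S → weight S b ≤ ∣ S ∣) → Decomposition z b 0
  decompose : ∀ {n} (z : Vec ℤ (suc n)) {b} → (∀ S → weight S b ≤ ∣ S ∣) → ∀ k →
    Decomposition z b k

  decompose₀ []       {[]} _     = decomposition refl refl refl
  decompose₀ (z ∷ zs)      bound = decompose (z ∷ zs) bound 0

  decompose {n} (z ∷ zs) {b ∷ bs} bound k = subst (Decomposition _ _) (+-identityʳ k)
    (decompose-∷ (splitCoordinate z b≤1 k) (decompose₀ zs (λ S → bound (outside ∷ S))))
    where
    b≤1 : b ≤ 1
    b≤1 = subst₂ _≤_ (trans (cong (ℕ._+_ b) (weight-⊥ bs)) (+-identityʳ b))
      (cong suc (Subsetₚ.∣⊥∣≡0 n)) (bound (inside ∷ ⊥))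

  module _ {n} (M : Matroid (suc n)) where

    open Matroid M

    -- A base b with b(A) = r A leaves z - b with positive part of sum excess z and
    -- negative part of sum deficiency z.
    Diagonal⇒latticePoint : ∀ {t u} z → Diagonal M t u z → Q-region M t u (map fromℤ z)
    Diagonal⇒latticePoint {t} {u} z (k , t≡ , u≡) =
      let b , b-bound , b-total , b-A = base-containing-basis-of M (posSupp z)
      in assemble b-bound b-total b-A (decompose z (λ S → ≤-trans (b-bound S) (r-bounded S)) k)
      where
      A = posSupp z

      assemble : ∀ {b} → (∀ S → weight S b ≤ r S) → weight ⊤ b ≡ rank → weight A b ≡ r A →
        Decomposition z b k → Q-region M t u (map fromℤ z)
      assemble {b} b-bound b-total b-A (decomposition {α} {β} z≡ Σα Σβ) =
        let c , c∈Δ , β≡ = dilatedSimplex t β Σβ≡t in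
        _ , _ ,
        (_ , _ , conv-⊇ {A = λ p → ∃[ x ] IsBase M x × p ≡ map fromℤ x}
                   (map ℤ.+_ b , isBase M b-bound b-total , refl) ,
                 dilatedSimplex u α Σα≡u , refl) ,
        -- The decomposition negates a point of tΔ, whereas the region dilates a point of ∇; the two
        -- scalings commute.
        (map (ℚ.- 1ℚ ℚ.*_) c , (c , c∈Δ , refl) ,
         trans (cong (map (ℚ.- 1ℚ ℚ.*_)) β≡) (map-*-comm c)) ,
        z≡
        where
        open ≡-Reasoning

        Σα≡u : sum α ≡ u
        Σα≡u = trans (+-cancelʳ-≡ (r A) _ _ (begin
          sum α + r A                ≡⟨ cong (ℕ._+_ (sum α)) b-A ⟨
          sum α + weight A b         ≡⟨ Σα ⟩
          pos z + k                  ≡⟨ cong (ℕ._+ k) (r+excess M z) ⟨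
          r A + excess M z + k       ≡⟨ rearrange (r A) _ k ⟩
          excess M z + k + r A       ∎)) (sym u≡)
          where
          rearrange : ∀ a b c → a + b + c ≡ b + c + a
          rearrange = ℕSolver.solve-∀

        Σβ≡t : sum β ≡ t
        Σβ≡t = trans (+-cancelʳ-≡ (r A) _ _ (begin
          sum β + r A                     ≡⟨ cong (ℕ._+_ (sum β)) b-A ⟨
          sum β + weight A b              ≡⟨ Σβ ⟩
          neg z + weight ⊤ b + k
            ≡⟨ cong (λ m → neg z + m + k) (trans b-total (sym (r+corank M A))) ⟩
          neg z + (r A + corank M A) + k  ≡⟨ rearrange (neg z) (r A) _ k ⟩
          deficiency M z + k + r A        ∎)) (sym t≡)
          where
          rearrange : ∀ a b c d → a + (b + c) + d ≡ a + c + d + b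
          rearrange = ℕSolver.solve-∀

        map-*-comm : ∀ {m} (c : Vec ℚ m) →
          map (ℚ.- 1ℚ ℚ.*_) (map (fromℕ t ℚ.*_) c) ≡ map (fromℕ t ℚ.*_) (map (ℚ.- 1ℚ ℚ.*_) c)
        map-*-comm c = trans (sym (map-∘ _ _ c)) (trans (map-cong swap c) (map-∘ _ _ c))
          where
          swap : ∀ x → ℚ.- 1ℚ ℚ.* (fromℕ t ℚ.* x) ≡ fromℕ t ℚ.* (ℚ.- 1ℚ ℚ.* x)
          swap x = trans (sym (ℚₚ.*-assoc (ℚ.- 1ℚ) (fromℕ t) x))
            (trans (cong (ℚ._* x) (ℚₚ.*-comm (ℚ.- 1ℚ) (fromℕ t))) (ℚₚ.*-assoc (fromℕ t) (ℚ.- 1ℚ) x))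

open LatticePoints

-- The identity for all invertible x, y and x+y-1 in a commutative ℚ-algebra

mainTheorem1 : ∀ {n} .{{_ : NonZero n}} (M : Matroid n)
    (Q : ℕ → ℕ → ℕ) → IsLatticePointCount M Q →
    ∀ {d} (c : Fin d → Fin d → ℚ) → IsBinomialExpansion Q c →
    ∀ {a ℓ} (R : CommutativeRing a ℓ) (ι : ℚ → CommutativeRing.Carrier R) →
    let open CommutativeRing R
        open Evaluation R ι
        open Matroid M using (rank)
    in IsAlgebraMap →
       ∀ (x y x⁻¹ y⁻¹ w⁻¹ : Carrier) →
       let w = x + y - 1# in
       x * x⁻¹ ≈ 1# → y * y⁻¹ ≈ 1# → w * w⁻¹ ≈ 1# →
       Q′ c x y ≈ x ^ (n ∸ rank) * y ^ rank * w⁻¹ * tutte M (w * y⁻¹) (w * x⁻¹)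
mainTheorem1 {suc n} M Q Q-counts c expansion R ι ι-hom x y x⁻¹ y⁻¹ w⁻¹ xx⁻¹≈1 yy⁻¹≈1 ww⁻¹≈1 =
  Q′-tutte R ι ι-hom M x y xx⁻¹≈1 yy⁻¹≈1 ww⁻¹≈1 Q
    (cumulativeCount M λ t u → card-cong
      (λ {z} → latticePoint⇒Diagonal M z) (λ {z} → Diagonal⇒latticePoint M z) (Q-counts t u))
    c expansion
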